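{- Let $G=(V,E,w)$ be a finite undirected loopless graph with $n$ vertices and nonnegative edge weights $w_e\ge0$ ($e\in E$). For every integer $k$ with $1\le k<n/2$, $$\lambda_{\max}\bigl(Q(F_k(G))\bigr)\le\lambda_{\max}\bigl(Q(F_{k+1}(G))\bigr),$$ $$\lambda_{\max}\bigl(A(F_k(G))\bigr)\le\lambda_{\max}\bigl(A(F_{k+1}(G))\bigr),$$ where $A(F_k(G))$ and $Q(F_k(G))$ denote the weighted adjacency matrix and the weighted signless Laplacian of the $k$-token graph $F_k(G)$.
   Context: Edges of $G$ are two-element subsets $\{i,j\}$ of $V$. No connectedness is assumed, and zero weights are allowed. For $0\le k\le n$, the weighted $k$-token graph $F_k(G)$ has vertex set $\binom{V}{k}=\{S\subseteq V:|S|=k\}$. Its weighted adjacency matrix $A(F_k(G))=A_k$, indexed by $\binom Vk$, has entries $(A_k)_{S,T}=w_{\{i,j\}}$ if the symmetric difference $S\triangle T=\{i,j\}$ is an edge in $E$, and $(A_k)_{S,T}=0$ otherwise. Its weighted degree matrix is $D_k=\operatorname{diag}(d_k(S):S\in\binom Vk)$ with $d_k(S)=\sum_{e\in E,\ |S\cap e|=1}w_e$. The signless Laplacian is $Q(F_k(G))=D_k+A_k$. $\lambda_{\max}(M)$ denotes the largest eigenvalue of a real symmetric matrix $M$. -}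

module Defs where

open import Algebra.Bundles using (CommutativeRing)
open import Data.Bool.Base using (Bool; T; if_then_else_)
open import Data.Bool.Properties using (T?) renaming (_≟_ to _≟ᵇ_)
open import Data.Fin.Subset using (Subset; inside; outside; ∣_∣; _∩_; _∪_; _─_)
open import Data.List.Base using (List; []; _∷_; _++_; map; foldr)
open import Data.Nat.Base using (ℕ; zero; suc)
open import Data.Nat.Properties using (_≟_)
open import Data.Product.Base using (Σ; ∃; _×_; _,_; proj₁)
open import Data.Vec.Base using ([]; _∷_)
open import Data.Vec.Properties using (≡-dec)
open import Level using (0ℓ)
open import Relation.Binary.Core using (Rel)
open import Relation.Binary.Structures using (IsDecTotalOrder)
open import Relation.Binary.PropositionalEquality using (_≡_; refl; cong)
open import Relation.Nullary using (¬_; does; yes; no)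
open import Relation.Unary using (Pred)

-- The real numbers, axiomatised as a complete ordered field; classically this
-- determines ℝ up to unique isomorphism.  The axioms are the classical ones:
-- the order is decidable and every inhabited predicate that is bounded above
-- has a least upper bound.
record CompleteOrderedField : Set₁ where
  infix 4 _≤_
  field
    commutativeRing : CommutativeRing 0ℓ 0ℓ

  open CommutativeRing commutativeRing public

  field
    _≤_             : Rel Carrier 0ℓ
    isDecTotalOrder : IsDecTotalOrder _≈_ _≤_
    0≉1             : ¬ (0# ≈ 1#)
    inverse         : ∀ x → ¬ (x ≈ 0#) → ∃ λ y → x * y ≈ 1#
    +-monoˡ-≤       : ∀ x y z → x ≤ y → x + z ≤ y + z
    *-nonneg        : ∀ x y → 0# ≤ x → 0# ≤ y → 0# ≤ x * y

  IsUpperBound : Pred Carrier 0ℓ → Pred Carrier 0ℓ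
  IsUpperBound P b = ∀ x → P x → x ≤ b

  field
    leastUpperBound : (P : Pred Carrier 0ℓ) → ∃ P → ∃ (IsUpperBound P) →
                      ∃ λ s → IsUpperBound P s × (∀ b → IsUpperBound P b → s ≤ b)

KSubset : ℕ → ℕ → Set
KSubset n k = Σ (Subset n) λ S → ∣ S ∣ ≡ k

insideᵏ : ∀ {n k} → KSubset n k → KSubset (suc n) (suc k)
insideᵏ (S , p) = inside ∷ S , cong suc p

outsideᵏ : ∀ {n k} → KSubset n k → KSubset (suc n) k
outsideᵏ (S , p) = outside ∷ S , p

-- Every k-element subset occurs exactly once.
kSubsets : ∀ n k → List (KSubset n k)
kSubsets zero    zero    = ([] , refl) ∷ []
kSubsets zero    (suc k) = []
kSubsets (suc n) zero    = map outsideᵏ (kSubsets n zero)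
kSubsets (suc n) (suc k) =
  map insideᵏ (kSubsets n k) ++ map outsideᵏ (kSubsets n (suc k))

infixl 6 _△_
_△_ : ∀ {n} → Subset n → Subset n → Subset n
S △ T = (S ─ T) ∪ (T ─ S)

module _ (ℝ : CompleteOrderedField) where
  open CompleteOrderedField ℝ

  ∑ : {A : Set} → List A → (A → Carrier) → Carrier
  ∑ xs f = foldr (λ x s → f x + s) 0# xs

  -- Loopless graphs on the vertex set Fin n: an edge is a two-element subset.
  record WeightedGraph (n : ℕ) : Set where
    field
      E : KSubset n 2 → Bool

    Edge : Set
    Edge = Σ (KSubset n 2) λ e → T (E e)

    field
      w        : Edge → Carrier
      w-nonneg : ∀ e → 0# ≤ w e

    -- w extended by zero to the two-element subsets that are not edges.
    w₀ : KSubset n 2 → Carrier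
    w₀ e with T? (E e)
    ... | yes e∈E = w (e , e∈E)
    ... | no  _   = 0#

  Matrix : ℕ → ℕ → Set
  Matrix n k = KSubset n k → KSubset n k → Carrier

  module _ {n : ℕ} (G : WeightedGraph n) (k : ℕ) where
    open WeightedGraph G

    tokenAdjacency : Matrix n k
    tokenAdjacency (S , _) (T , _) with ∣ S △ T ∣ ≟ 2
    ... | yes p = w₀ (S △ T , p)
    ... | no  _ = 0#

    tokenDegree : KSubset n k → Carrier
    tokenDegree (S , _) =
      ∑ (kSubsets n 2) λ e → if does (∣ S ∩ proj₁ e ∣ ≟ 1) then w₀ e else 0#

    tokenDegreeMatrix : Matrix n k
    tokenDegreeMatrix S T =
      if does (≡-dec _≟ᵇ_ (proj₁ S) (proj₁ T)) then tokenDegree S else 0#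

    tokenSignlessLaplacian : Matrix n k
    tokenSignlessLaplacian S T = tokenDegreeMatrix S T + tokenAdjacency S T

  module _ {n k : ℕ} (M : Matrix n k) where

    IsEigenvalue : Carrier → Set
    IsEigenvalue μ =
      Σ (KSubset n k → Carrier) λ v →
        (∃ λ S → ¬ (v S ≈ 0#)) ×
        (∀ S → ∑ (kSubsets n k) (λ T → M S T * v T) ≈ μ * v S)

    IsLargestEigenvalue : Carrier → Set
    IsLargestEigenvalue μ = IsEigenvalue μ × (∀ ν → IsEigenvalue ν → ν ≤ μ)

{-# OPTIONS --safe #-}
module Submission where

-- For a pair e write τ for the transposition of its two vertices acting on functions of subsets, and h for the
-- operator f ↦ [|S ∩ e| = 1] (f S + f (S △ e)).  Then Q = Σ wₑ hₑ and 2A + Σ wₑ = Σ wₑ (τₑ + hₑ) on every level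
-- at once.  Call a partial matching's indicator the function testing whether S contains exactly one vertex of
-- every matched pair: hₑ and τₑ map such indicators to multiples of such indicators (the action of the Brauer
-- algebra).  With p pairs and q unmatched vertices the number of k-subsets passing the test is the coefficient
-- of tᵏ in (2t)ᵖ (1 + t)ᑫ, which increases in k below n/2.  Hence Σ_S (Mᴺ𝟙)(S) over k-subsets is at most the same
-- sum over (k+1)-subsets, for every N.  As M is symmetric and nonnegative, these sums grow like the N-th powers
-- of the largest eigenvalues, which are therefore ordered in the same way.

open import Defs hiding (∑)
import Defs
import Algebra.Properties.AbelianGroup as AbelianGroupProperties
import Algebra.Properties.Ring as RingProperties
import Algebra.Properties.Semiring.Mult.TCOptimised as Multiples
import Algebra.Solver.Ring as RingSolver
open import Algebra.Solver.Ring.AlmostCommutativeRing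
  using (fromCommutativeRing; _-Raw-AlmostCommutative⟶_)
open import Data.Bool.Base using (Bool; true; false; T; not; _∧_; _xor_; if_then_else_)
open import Data.Bool.Properties using (T?; xor-comm; xor-identityʳ; ∧-assoc; ∧-comm)
  renaming (_≟_ to _≟ᵇ_)
open import Data.Fin.Base using (Fin; zero; suc)
open import Data.Fin.Properties using () renaming (_≟_ to _≟ᶠ_)
open import Data.Fin.Subset using (Subset; inside; outside; ∣_∣; _∩_)
open import Data.Integer.Base as ℤ using (ℤ; -[1+_]; _⊖_; _◃_)
import Data.Integer.Properties as ℤₚ
open import Data.List.Base using (List; []; _∷_; _++_; map; length; allFin)
open import Data.List.Membership.Propositional using (_∈_)
open import Data.List.Membership.Propositional.Properties
  using (∈-map⁺; ∈-map⁻; ∈-++⁺ˡ; ∈-++⁺ʳ; ∈-allFin)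
open import Data.List.Properties using (map-tabulate; length-tabulate)
open import Data.List.Relation.Binary.Permutation.Propositional
  using (_↭_; prep; swap; ↭-refl; ↭-reflexive; ↭-sym; ↭-trans; ↭⇒↭ₛ)
open import Data.List.Relation.Binary.Permutation.Propositional.Properties
  using (∈-resp-↭; ↭-length; shifts; ++⁺ˡ)
import Data.List.Relation.Binary.Permutation.Setoid.Properties as SetoidPermutation
open import Data.List.Relation.Unary.All as All using (All; []; _∷_)
open import Data.List.Relation.Unary.AllPairs using ([]; _∷_)
open import Data.List.Relation.Unary.Any using (here; there)
open import Data.List.Relation.Unary.Unique.Propositional using (Unique)
import Data.List.Relation.Unary.Unique.Propositional.Properties as Unique
open import Data.Maybe.Base using (Maybe; just; nothing)
open import Data.Nat.Base as ℕ using (ℕ; zero; suc; z≤n; s≤s)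
open import Data.Nat.GeneralisedArithmetic using (fold)
import Data.Nat.Properties as ℕₚ
open import Data.Product.Base using (∃; _×_; _,_; proj₁; proj₂)
import Data.Sign.Base as Sign
open import Data.Sum.Base using (_⊎_; inj₁; inj₂; [_,_]′)
open import Data.Vec.Base using ([]; _∷_; _[_]≔_; lookup; replicate; zipWith)
open import Data.Vec.Properties
  using (≡-dec; lookup-zipWith; zipWith-comm; lookup∘update; lookup∘update′; []≔-commutes)
open import Function.Base using (_∘_)
open import Level using (0ℓ)
open import Relation.Binary.Bundles using (Poset)
open import Relation.Binary.Definitions using (DecidableEquality)
open import Relation.Binary.PropositionalEquality as ≡ using (_≡_; _≢_; cong; cong₂)
import Relation.Binary.Reasoning.PartialOrder as PartialOrderReasoning
import Relation.Binary.Reasoning.Setoid as SetoidReasoning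
open import Relation.Binary.Structures using (IsDecTotalOrder)
open import Relation.Nullary using (¬_; yes; no; does; contradiction)

-- The two levels are compared through a number, not through a map between eigenvectors: the
-- matrices involved are restrictions of one operator on functions of all subsets, and the sum over
-- a level is linear, so it suffices to compare the generators of a cone that the operator
-- preserves. Only even exponents are compared, because the sum of `M²ᴺ𝟙` is the squared norm of
-- `Mᴺ𝟙`. Its growth is controlled by an upper bound on the Rayleigh quotients alone, since for
-- nonnegative entries the negative of that bound is a lower one. For the growth from below any
-- eigenvector will do: a nonnegative matrix preserves its domination by a constant vector. That
-- Rayleigh quotients stay below the largest eigenvalue comes from the least-upper-bound axiom,
-- without compactness or diagonalisation: by elimination a semidefinite form has an isotropic
-- vector or is coercive, and coercivity would allow the supremum to be lowered.

module OrderedField (ℝ : CompleteOrderedField) where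

  open import Data.Integer.Base using (+_)
  open CompleteOrderedField ℝ hiding (zero)

  open RingProperties ring using (-‿distribˡ-*; -‿distribʳ-*; -‿involutive; -0#≈0#)
  open AbelianGroupProperties +-abelianGroup using (⁻¹-∙-comm)
  open Multiples semiring using (1+×; ×1-homo-*)
    renaming (_×_ to _×′_; ×-homo-+ to ×′-homo-+)

  module ≈-Reasoning = SetoidReasoning setoid

  -- Integers in the field, as coefficients for the ring solver

  fromℤ : ℤ → Carrier
  fromℤ (+ n)    = n ×′ 1#
  fromℤ -[1+ n ] = - (suc n ×′ 1#)

  fromℤ-⊖ : ∀ m n → fromℤ (m ⊖ n) ≈ m ×′ 1# - n ×′ 1#
  fromℤ-⊖ m       zero    = sym (trans (+-congˡ -0#≈0#) (+-identityʳ _))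
  fromℤ-⊖ zero    (suc n) = sym (+-identityˡ _)
  fromℤ-⊖ (suc m) (suc n) = begin
    fromℤ (suc m ⊖ suc n)                  ≡⟨ ≡.cong fromℤ (ℤₚ.[1+m]⊖[1+n]≡m⊖n m n) ⟩
    fromℤ (m ⊖ n)                          ≈⟨ fromℤ-⊖ m n ⟩
    a - b                                  ≈⟨ +-congˡ (+-identityˡ _) ⟨
    a + (0# - b)                           ≈⟨ +-congˡ (+-congʳ (-‿inverseʳ 1#)) ⟨
    a + ((1# - 1#) - b)                    ≈⟨ +-congˡ (trans (+-assoc _ _ _) (+-congˡ (⁻¹-∙-comm 1# b))) ⟩
    a + (1# - (1# + b))                    ≈⟨ +-assoc _ _ _ ⟨
    (a + 1#) - (1# + b)
      ≈⟨ +-cong (trans (+-comm a 1#) (sym (1+× m 1#))) (-‿cong (sym (1+× n 1#))) ⟩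
    suc m ×′ 1# - suc n ×′ 1#              ∎
    where open ≈-Reasoning
          a = m ×′ 1#
          b = n ×′ 1#

  fromℤ-+ : ∀ i j → fromℤ (i ℤ.+ j) ≈ fromℤ i + fromℤ j
  fromℤ-+ (+ m)    (+ n)    = ×′-homo-+ 1# m n
  fromℤ-+ (+ m)    -[1+ n ] = fromℤ-⊖ m (suc n)
  fromℤ-+ -[1+ m ] (+ n)    = trans (fromℤ-⊖ n (suc m)) (+-comm _ _)
  fromℤ-+ -[1+ m ] -[1+ n ] = begin
    - (suc (suc (m ℕ.+ n)) ×′ 1#)    ≡⟨ ≡.cong (λ k → - (suc k ×′ 1#)) (ℕₚ.+-suc m n) ⟨
    - ((suc m ℕ.+ suc n) ×′ 1#)      ≈⟨ -‿cong (×′-homo-+ 1# (suc m) (suc n)) ⟩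
    - (suc m ×′ 1# + suc n ×′ 1#)    ≈⟨ ⁻¹-∙-comm _ _ ⟨
    - (suc m ×′ 1#) - (suc n ×′ 1#)  ∎
    where open ≈-Reasoning

  fromℤ-neg : ∀ i → fromℤ (ℤ.- i) ≈ - fromℤ i
  fromℤ-neg (+ zero)  = sym -0#≈0#
  fromℤ-neg (+ suc n) = refl
  fromℤ-neg -[1+ n ]  = sym (-‿involutive _)

  fromℤ-+◃ : ∀ n → fromℤ (Sign.+ ◃ n) ≈ n ×′ 1#
  fromℤ-+◃ zero    = refl
  fromℤ-+◃ (suc n) = refl

  fromℤ--◃ : ∀ n → fromℤ (Sign.- ◃ n) ≈ - (n ×′ 1#)
  fromℤ--◃ zero    = sym -0#≈0#
  fromℤ--◃ (suc n) = refl

  fromℤ-* : ∀ i j → fromℤ (i ℤ.* j) ≈ fromℤ i * fromℤ j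
  fromℤ-* (+ m)    (+ n)    = trans (fromℤ-+◃ (m ℕ.* n)) (×1-homo-* m n)
  fromℤ-* (+ m)    -[1+ n ] = trans (fromℤ--◃ (m ℕ.* suc n))
    (trans (-‿cong (×1-homo-* m (suc n))) (-‿distribʳ-* _ _))
  fromℤ-* -[1+ m ] (+ n)    = trans (fromℤ--◃ (suc m ℕ.* n))
    (trans (-‿cong (×1-homo-* (suc m) n)) (-‿distribˡ-* _ _))
  fromℤ-* -[1+ m ] -[1+ n ] = begin
    fromℤ (Sign.+ ◃ (suc m ℕ.* suc n)) ≈⟨ ×1-homo-* (suc m) (suc n) ⟩
    a * b                              ≈⟨ -‿involutive _ ⟨
    - (- (a * b))                      ≈⟨ -‿cong (-‿distribˡ-* a b) ⟩
    - (- a * b)                        ≈⟨ -‿distribʳ-* (- a) b ⟩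
    - a * - b                          ∎
    where open ≈-Reasoning
          a = suc m ×′ 1#
          b = suc n ×′ 1#

  fromℤ-homomorphism : ℤ.+-*-rawRing -Raw-AlmostCommutative⟶ fromCommutativeRing commutativeRing
  fromℤ-homomorphism = record
    { ⟦_⟧ = fromℤ ; +-homo = fromℤ-+ ; *-homo = fromℤ-* ; -‿homo = fromℤ-neg
    ; 0-homo = refl ; 1-homo = refl }

  fromℤ-≟ : ∀ i j → Maybe (fromℤ i ≈ fromℤ j)
  fromℤ-≟ i j with i ℤₚ.≟ j
  ... | yes i≡j = just (reflexive (≡.cong fromℤ i≡j))
  ... | no  _   = nothing

  open RingSolver ℤ.+-*-rawRing (fromCommutativeRing commutativeRing) fromℤ-homomorphism fromℤ-≟ public
    using (solve; con; _:=_; _:+_; _:*_; _:-_; :-_)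

  -- Ordered field arithmetic

  open IsDecTotalOrder isDecTotalOrder public
    using (total; antisym; _≤?_; isPartialOrder; ≤-respˡ-≈; ≤-respʳ-≈)
    renaming (refl to ≤-refl; reflexive to ≤-reflexive; trans to ≤-trans; _≟_ to _≈?_)

  poset : Poset 0ℓ 0ℓ 0ℓ
  poset = record { isPartialOrder = isPartialOrder }

  module ≤-Reasoning = PartialOrderReasoning poset

  ≰⇒≥ : ∀ {x y} → ¬ (x ≤ y) → y ≤ x
  ≰⇒≥ {x} {y} x≰y = [ (λ x≤y → contradiction x≤y x≰y) , (λ y≤x → y≤x) ]′ (total x y)

  +-mono-≤ : ∀ {x y u v} → x ≤ y → u ≤ v → x + u ≤ y + v
  +-mono-≤ {x} {y} {u} {v} x≤y u≤v = ≤-trans (+-monoˡ-≤ x y u x≤y)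
    (≤-respˡ-≈ (+-comm u y) (≤-respʳ-≈ (+-comm v y) (+-monoˡ-≤ u v y u≤v)))

  +-nonneg : ∀ {x y} → 0# ≤ x → 0# ≤ y → 0# ≤ x + y
  +-nonneg 0≤x 0≤y = ≤-respˡ-≈ (+-identityˡ 0#) (+-mono-≤ 0≤x 0≤y)

  ≤-by : ∀ {x y} d → 0# ≤ d → x + d ≈ y → x ≤ y
  ≤-by {x} d 0≤d x+d≈y = ≤-respˡ-≈ (+-identityʳ x) (≤-respʳ-≈ x+d≈y (+-mono-≤ ≤-refl 0≤d))

  ≤⇒0≤ : ∀ {x y} → x ≤ y → 0# ≤ y - x
  ≤⇒0≤ {x} {y} x≤y = ≤-respˡ-≈ (-‿inverseʳ x) (+-monoˡ-≤ x y (- x) x≤y)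

  0≤⇒≤ : ∀ {x y} → 0# ≤ y - x → x ≤ y
  0≤⇒≤ {x} {y} 0≤d = ≤-by (y - x) 0≤d (solve 2 (λ x y → x :+ (y :- x) := y) refl x y)

  ≤0⇒0≤- : ∀ {x} → x ≤ 0# → 0# ≤ - x
  ≤0⇒0≤- x≤0 = ≤-respʳ-≈ (+-identityˡ _) (≤⇒0≤ x≤0)

  *-monoˡ-≤ : ∀ {x y} z → 0# ≤ z → x ≤ y → z * x ≤ z * y
  *-monoˡ-≤ {x} {y} z 0≤z x≤y = ≤-by (z * (y - x)) (*-nonneg z _ 0≤z (≤⇒0≤ x≤y))
    (solve 3 (λ x y z → z :* x :+ z :* (y :- x) := z :* y) refl x y z)

  0≤x² : ∀ x → 0# ≤ x * x
  0≤x² x with total 0# x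
  ... | inj₁ 0≤x = *-nonneg x x 0≤x 0≤x
  ... | inj₂ x≤0 = ≤-respʳ-≈ (solve 1 (λ x → (:- x) :* (:- x) := x :* x) refl x)
    (*-nonneg (- x) (- x) (≤0⇒0≤- x≤0) (≤0⇒0≤- x≤0))

  0≤1 : 0# ≤ 1#
  0≤1 = ≤-respʳ-≈ (*-identityˡ 1#) (0≤x² 1#)

  1≰0 : ¬ (1# ≤ 0#)
  1≰0 1≤0 = 0≉1 (antisym 0≤1 1≤0)

  2≰0 : ¬ (1# + 1# ≤ 0#)
  2≰0 2≤0 = 1≰0 (≤-trans (≤-by 1# 0≤1 refl) 2≤0)

  ½ : Carrier
  ½ = proj₁ (inverse (1# + 1#) (λ 2≈0 → 2≰0 (≤-reflexive 2≈0)))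

  2*½≈1 : (1# + 1#) * ½ ≈ 1#
  2*½≈1 = proj₂ (inverse (1# + 1#) (λ 2≈0 → 2≰0 (≤-reflexive 2≈0)))

  x+x≈2x : ∀ x → x + x ≈ (1# + 1#) * x
  x+x≈2x = solve 1 (λ x → x :+ x := (con (+ 1) :+ con (+ 1)) :* x) refl

  double-halve : ∀ x → ½ * x + ½ * x ≈ x
  double-halve x = trans (x+x≈2x _) (trans (sym (*-assoc _ _ _)) (trans (*-congʳ 2*½≈1) (*-identityˡ x)))

  inverse-nonneg : ∀ {x y} → 0# ≤ x → x * y ≈ 1# → 0# ≤ y
  inverse-nonneg {x} {y} 0≤x xy≈1 = ≤-respʳ-≈ eq (*-nonneg _ _ 0≤x (0≤x² y))
    where
    eq : x * (y * y) ≈ y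
    eq = trans (sym (*-assoc x y y)) (trans (*-congʳ xy≈1) (*-identityˡ y))

  *-cancelˡ-≤ : ∀ {x y} z → ¬ (z ≤ 0#) → z * x ≤ z * y → x ≤ y
  *-cancelˡ-≤ {x} {y} z z≰0 zx≤zy
    with w , zw≈1 ← inverse z (λ z≈0 → z≰0 (≤-reflexive z≈0)) =
    ≤-respˡ-≈ (cancel x) (≤-respʳ-≈ (cancel y)
      (*-monoˡ-≤ w (inverse-nonneg (≰⇒≥ z≰0) zw≈1) zx≤zy))
    where
    cancel : ∀ x → w * (z * x) ≈ x
    cancel x = trans (sym (*-assoc w z x)) (trans (*-congʳ (trans (*-comm w z) zw≈1)) (*-identityˡ x))

  x²≈0⇒x≈0 : ∀ {x} → x * x ≈ 0# → x ≈ 0#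
  x²≈0⇒x≈0 {x} x²≈0 with x ≈? 0#
  ... | yes x≈0 = x≈0
  ... | no  x≉0 with y , xy≈1 ← inverse x x≉0 = contradiction (sym 1≈0) 0≉1
    where
    1≈0 : 1# ≈ 0#
    1≈0 = trans (sym (*-identityˡ 1#)) (trans (*-cong (sym xy≈1) (sym xy≈1))
      (trans (solve 2 (λ x y → x :* y :* (x :* y) := x :* x :* (y :* y)) refl x y)
        (trans (*-congʳ x²≈0) (zeroˡ _))))

  x+y≤0⇒x≈0 : ∀ {x y} → 0# ≤ x → 0# ≤ y → x + y ≤ 0# → x ≈ 0#
  x+y≤0⇒x≈0 {x} {y} 0≤x 0≤y x+y≤0 = antisym (≤-trans (≤-by y 0≤y refl) x+y≤0) 0≤x

  x≰x-ε : ∀ {x ε} → ¬ (ε ≤ 0#) → ¬ (x ≤ x - ε)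
  x≰x-ε {x} {ε} ε≰0 x≤x-ε = ε≰0 (≤-by _ (≤⇒0≤ x≤x-ε)
    (solve 2 (λ x ε → ε :+ (x :- ε :- x) := con (+ 0)) refl x ε))

  -- Growth of powers

  infixr 8 _^_
  _^_ : Carrier → ℕ → Carrier
  x ^ zero  = 1#
  x ^ suc n = x * x ^ n

  ^-nonneg : ∀ {x} → 0# ≤ x → ∀ n → 0# ≤ x ^ n
  ^-nonneg 0≤x zero    = 0≤1
  ^-nonneg 0≤x (suc n) = *-nonneg _ _ 0≤x (^-nonneg 0≤x n)

  *-^ : ∀ x y n → (x * y) ^ n ≈ x ^ n * y ^ n
  *-^ x y zero    = sym (*-identityˡ 1#)
  *-^ x y (suc n) = trans (*-congˡ (*-^ x y n))
    (solve 4 (λ x y a b → x :* y :* (a :* b) := x :* a :* (y :* b)) refl x y (x ^ n) (y ^ n))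

  -- If s is the supremum of the powers of x > 1, then so is s / x.
  bounded-powers⇒≤1 : ∀ x C → 0# ≤ x → (∀ n → x ^ n ≤ C) → x ≤ 1#
  bounded-powers⇒≤1 x C 0≤x x^n≤C with x ≤? 1#
  ... | yes x≤1 = x≤1
  ... | no  x≰1
    with y , xy≈1 ← inverse x (λ x≈0 → x≰1 (≤-trans (≤-reflexive x≈0) 0≤1))
    with s , ub , lub ← leastUpperBound (λ p → ∃ λ n → p ≈ x ^ n) (1# , 0 , refl)
                          (C , λ { p (n , p≈) → ≤-trans (≤-reflexive p≈) (x^n≤C n) })
    = *-cancelˡ-≤ s s≰0 (≤-respʳ-≈ (sym (*-identityʳ s)) (≤-respˡ-≈ (*-comm x s) xs≤s))
    where
    x≰0 : ¬ (x ≤ 0#)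
    x≰0 x≤0 = x≰1 (≤-trans x≤0 0≤1)
    x*y*s≈s : x * (y * s) ≈ s
    x*y*s≈s = trans (sym (*-assoc x y s)) (trans (*-congʳ xy≈1) (*-identityˡ s))
    s≤ys : s ≤ y * s
    s≤ys = lub (y * s) λ { p (n , p≈) → *-cancelˡ-≤ x x≰0
      (≤-respʳ-≈ (sym x*y*s≈s) (ub _ (suc n , *-congˡ p≈))) }
    xs≤s : x * s ≤ s
    xs≤s = ≤-respʳ-≈ x*y*s≈s (*-monoˡ-≤ x 0≤x s≤ys)
    s≰0 : ¬ (s ≤ 0#)
    s≰0 s≤0 = 1≰0 (≤-trans (ub 1# (0 , refl)) s≤0)

  -- Dividing by `y ^ n * c` bounds all powers of the quotient of `x` by `y`, so that quotient is at
  -- most one. The constants `c` and `C` do not affect the rate of growth.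
  dominated-powers⇒≤ : ∀ {x y c C} → 0# ≤ x → ¬ (y ≤ 0#) → ¬ (c ≤ 0#) →
                       (∀ n → x ^ n * c ≤ y ^ n * C) → x ≤ y
  dominated-powers⇒≤ {x} {y} {c} {C} 0≤x y≰0 c≰0 dominated
    with z , yz≈1 ← inverse y (λ y≈0 → y≰0 (≤-reflexive y≈0))
    with d , cd≈1 ← inverse c (λ c≈0 → c≰0 (≤-reflexive c≈0)) =
    ≤-respˡ-≈ eq (≤-respʳ-≈ (*-identityʳ y) (*-monoˡ-≤ y (≰⇒≥ y≰0)
      (bounded-powers⇒≤1 (z * x) (C * d) (*-nonneg z x 0≤z 0≤x) bound)))
    where
    0≤z = inverse-nonneg (≰⇒≥ y≰0) yz≈1
    0≤d = inverse-nonneg (≰⇒≥ c≰0) cd≈1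
    eq : y * (z * x) ≈ x
    eq = trans (sym (*-assoc y z x)) (trans (*-congʳ yz≈1) (*-identityˡ x))
    1^ : ∀ n → 1# ^ n ≈ 1#
    1^ zero    = refl
    1^ (suc n) = trans (*-identityˡ _) (1^ n)
    ^-cong : ∀ {a b} n → a ≈ b → a ^ n ≈ b ^ n
    ^-cong zero    a≈b = refl
    ^-cong (suc n) a≈b = *-cong a≈b (^-cong n a≈b)
    zy^ : ∀ n → z ^ n * y ^ n ≈ 1#
    zy^ n = trans (sym (*-^ z y n)) (trans (^-cong n (trans (*-comm z y) yz≈1)) (1^ n))
    bound : ∀ n → (z * x) ^ n ≤ C * d
    bound n = begin
      (z * x) ^ n                   ≈⟨ *-^ z x n ⟩
      z ^ n * x ^ n                 ≈⟨ *-identityʳ _ ⟨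
      z ^ n * x ^ n * 1#            ≈⟨ *-congˡ cd≈1 ⟨
      z ^ n * x ^ n * (c * d)
        ≈⟨ solve 4 (λ a b c d → a :* b :* (c :* d) := a :* d :* (b :* c)) refl (z ^ n) (x ^ n) c d ⟩
      z ^ n * d * (x ^ n * c)       ≤⟨ *-monoˡ-≤ _ (*-nonneg _ _ (^-nonneg 0≤z n) 0≤d) (dominated n) ⟩
      z ^ n * d * (y ^ n * C)
        ≈⟨ solve 4 (λ a b c d → a :* d :* (b :* c) := a :* b :* (c :* d)) refl (z ^ n) (y ^ n) C d ⟩
      z ^ n * y ^ n * (C * d)       ≈⟨ *-congʳ (zy^ n) ⟩
      1# * (C * d)                  ≈⟨ *-identityˡ _ ⟩
      C * d                         ∎
      where open ≤-Reasoning

module QuadraticForms (ℝ : CompleteOrderedField) where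

  open import Data.Integer.Base using (+_)
  open CompleteOrderedField ℝ hiding (zero)
  open OrderedField ℝ

  -- Finite sums, vectors and matrices

  ∑ : {A : Set} → List A → (A → Carrier) → Carrier
  ∑ = Defs.∑ ℝ

  module _ {A : Set} where

    ∑-cong-∈ : ∀ (xs : List A) {f g} → (∀ {x} → x ∈ xs → f x ≈ g x) → ∑ xs f ≈ ∑ xs g
    ∑-cong-∈ []       f≈g = refl
    ∑-cong-∈ (x ∷ xs) f≈g = +-cong (f≈g (here ≡.refl)) (∑-cong-∈ xs (f≈g ∘ there))

    ∑-cong : ∀ (xs : List A) {f g} → (∀ x → f x ≈ g x) → ∑ xs f ≈ ∑ xs g
    ∑-cong xs f≈g = ∑-cong-∈ xs (λ {x} _ → f≈g x)

    ∑-mono-≤ : ∀ (xs : List A) {f g} → (∀ x → f x ≤ g x) → ∑ xs f ≤ ∑ xs g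
    ∑-mono-≤ []       f≤g = ≤-refl
    ∑-mono-≤ (x ∷ xs) f≤g = +-mono-≤ (f≤g x) (∑-mono-≤ xs f≤g)

    ∑-nonneg : ∀ (xs : List A) {f} → (∀ x → 0# ≤ f x) → 0# ≤ ∑ xs f
    ∑-nonneg []       0≤f = ≤-refl
    ∑-nonneg (x ∷ xs) 0≤f = +-nonneg (0≤f x) (∑-nonneg xs 0≤f)

    ∑-zero : ∀ (xs : List A) {f} → (∀ {x} → x ∈ xs → f x ≈ 0#) → ∑ xs f ≈ 0#
    ∑-zero []       f≈0 = refl
    ∑-zero (x ∷ xs) f≈0 = trans (+-cong (f≈0 (here ≡.refl)) (∑-zero xs (f≈0 ∘ there))) (+-identityˡ 0#)

    ∑-+ : ∀ (xs : List A) f g → ∑ xs (λ x → f x + g x) ≈ ∑ xs f + ∑ xs g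
    ∑-+ []       f g = sym (+-identityˡ 0#)
    ∑-+ (x ∷ xs) f g = trans (+-congˡ (∑-+ xs f g))
      (solve 4 (λ a b c d → a :+ b :+ (c :+ d) := a :+ c :+ (b :+ d)) refl (f x) (g x) (∑ xs f) (∑ xs g))

    ∑-*ˡ : ∀ (xs : List A) c f → ∑ xs (λ x → c * f x) ≈ c * ∑ xs f
    ∑-*ˡ []       c f = sym (zeroʳ c)
    ∑-*ˡ (x ∷ xs) c f = trans (+-congˡ (∑-*ˡ xs c f)) (sym (distribˡ c _ _))

    term≤∑ : ∀ {xs : List A} {f x} → (∀ x → 0# ≤ f x) → x ∈ xs → f x ≤ ∑ xs f
    term≤∑ {_ ∷ xs} 0≤f (here ≡.refl) = ≤-by _ (∑-nonneg xs 0≤f) refl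
    term≤∑ {y ∷ xs} 0≤f (there x∈xs) = ≤-trans (term≤∑ 0≤f x∈xs) (≤-by _ (0≤f y) (+-comm _ _))

    ∑-++ : ∀ (xs ys : List A) f → ∑ (xs ++ ys) f ≈ ∑ xs f + ∑ ys f
    ∑-++ []       ys f = sym (+-identityˡ _)
    ∑-++ (x ∷ xs) ys f = trans (+-congˡ (∑-++ xs ys f)) (sym (+-assoc _ _ _))

  module _ {A B : Set} where

    ∑-map : ∀ (g : A → B) xs f → ∑ (map g xs) f ≡ ∑ xs (f ∘ g)
    ∑-map g []       f = ≡.refl
    ∑-map g (x ∷ xs) f = ≡.cong (λ s → f (g x) + s) (∑-map g xs f)

    ∑-swap : ∀ (xs : List A) (ys : List B) (f : A → B → Carrier) → ∑ xs (λ x → ∑ ys (f x))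
      ≈ ∑ ys (λ y → ∑ xs (λ x → f x y))
    ∑-swap []       ys f = sym (∑-zero ys (λ _ → refl))
    ∑-swap (x ∷ xs) ys f = trans (+-congˡ (∑-swap xs ys f)) (sym (∑-+ ys (f x) _))

  module _ {I : Set} where

    Vector : Set
    Vector = I → Carrier

    Matrixᴵ : Set
    Matrixᴵ = I → I → Carrier

    Symmetric : Matrixᴵ → Set
    Symmetric M = ∀ i j → M i j ≈ M j i

    infixl 6 _⊕_
    _⊕_ : Vector → Vector → Vector
    (x ⊕ y) i = x i + y i

    infixr 7 _⊙_
    _⊙_ : Carrier → Vector → Vector
    (c ⊙ x) i = c * x i

  module _ {I : Set} (xs : List I) where

    dot : Vector → Vector → Carrier
    dot x y = ∑ xs λ i → x i * y i

    mul : Matrixᴵ → Vector → Vector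
    mul M v i = ∑ xs λ j → M i j * v j

    quad : Matrixᴵ → Vector → Carrier
    quad M v = dot v (mul M v)

  module _ {I : Set} (xs : List I) where

    dot-cong : ∀ {x y u v} → (∀ {i} → i ∈ xs → x i ≈ y i) → (∀ {i} → i ∈ xs → u i ≈ v i) → dot xs x u ≈ dot xs y v
    dot-cong x≈y u≈v = ∑-cong-∈ xs (λ i∈ → *-cong (x≈y i∈) (u≈v i∈))

    dot-comm : ∀ x y → dot xs x y ≈ dot xs y x
    dot-comm x y = ∑-cong xs (λ i → *-comm _ _)

    dot-⊕ˡ : ∀ x y z → dot xs (x ⊕ y) z ≈ dot xs x z + dot xs y z
    dot-⊕ˡ x y z = trans (∑-cong xs (λ i → distribʳ _ _ _)) (∑-+ xs _ _)

    dot-⊙ˡ : ∀ c x y → dot xs (c ⊙ x) y ≈ c * dot xs x y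
    dot-⊙ˡ c x y = trans (∑-cong xs (λ i → *-assoc _ _ _)) (∑-*ˡ xs c _)

    dot-⊕ʳ : ∀ x y z → dot xs x (y ⊕ z) ≈ dot xs x y + dot xs x z
    dot-⊕ʳ x y z = trans (∑-cong xs (λ i → distribˡ _ _ _)) (∑-+ xs _ _)

    dot-⊙ʳ : ∀ c x y → dot xs x (c ⊙ y) ≈ c * dot xs x y
    dot-⊙ʳ c x y = trans (dot-comm _ _) (trans (dot-⊙ˡ c y x) (*-congˡ (dot-comm y x)))

    dot-self-nonneg : ∀ x → 0# ≤ dot xs x x
    dot-self-nonneg x = ∑-nonneg xs (λ i → 0≤x² (x i))

    dot-self≈0 : ∀ {x} → dot xs x x ≈ 0# → ∀ {i} → i ∈ xs → x i ≈ 0#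
    dot-self≈0 {x} x·x≈0 i∈ = x²≈0⇒x≈0 (antisym (≤-trans (term≤∑ (λ i → 0≤x² (x i)) i∈) (≤-reflexive x·x≈0)) (0≤x² _))

    mul-cong : ∀ M {x y} → (∀ {i} → i ∈ xs → x i ≈ y i) → ∀ i → mul xs M x i ≈ mul xs M y i
    mul-cong M x≈y i = ∑-cong-∈ xs (λ j∈ → *-congˡ (x≈y j∈))

    mul-⊕ : ∀ M x y i → mul xs M (x ⊕ y) i ≈ (mul xs M x ⊕ mul xs M y) i
    mul-⊕ M x y i = dot-⊕ʳ (M i) x y

    mul-⊙ : ∀ M c x i → mul xs M (c ⊙ x) i ≈ (c ⊙ mul xs M x) i
    mul-⊙ M c x i = dot-⊙ʳ c (M i) x

    quad-cong : ∀ M {x y} → (∀ {i} → i ∈ xs → x i ≈ y i) → quad xs M x ≈ quad xs M y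
    quad-cong M x≈y = dot-cong x≈y (λ {i} _ → mul-cong M x≈y i)

    mul-selfAdjoint : ∀ {M} → Symmetric M → ∀ x y → dot xs x (mul xs M y) ≈ dot xs (mul xs M x) y
    mul-selfAdjoint {M} M-sym x y = begin
      ∑ xs (λ i → x i * ∑ xs (λ j → M i j * y j))      ≈⟨ ∑-cong xs (λ i → ∑-*ˡ xs (x i) _) ⟨
      ∑ xs (λ i → ∑ xs (λ j → x i * (M i j * y j)))    ≈⟨ ∑-swap xs xs _ ⟩
      ∑ xs (λ j → ∑ xs (λ i → x i * (M i j * y j)))    ≈⟨ ∑-cong xs (λ j → ∑-cong xs (λ i →
        trans (*-congˡ (*-congʳ (M-sym i j)))
          (solve 3 (λ x m y → x :* (m :* y) := y :* (m :* x)) refl (x i) (M j i) (y j)))) ⟩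
      ∑ xs (λ j → ∑ xs (λ i → y j * (M j i * x i)))    ≈⟨ ∑-cong xs (λ j → ∑-*ˡ xs (y j) _) ⟩
      ∑ xs (λ j → y j * ∑ xs (λ i → M j i * x i))      ≈⟨ dot-comm _ _ ⟩
      dot xs (mul xs M x) y ∎
      where open ≈-Reasoning

    quad-⊕ : ∀ {M} → Symmetric M → ∀ x y →
             quad xs M (x ⊕ y) ≈ quad xs M x + dot xs y (mul xs M x) + dot xs y (mul xs M x) + quad xs M y
    quad-⊕ {M} M-sym x y = begin
      dot xs (x ⊕ y) (mul xs M (x ⊕ y))    ≈⟨ dot-cong (λ _ → refl) (λ {i} _ → mul-⊕ M x y i) ⟩
      dot xs (x ⊕ y) (Mx ⊕ My)             ≈⟨ dot-⊕ˡ x y _ ⟩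
      dot xs x (Mx ⊕ My) + dot xs y (Mx ⊕ My)   ≈⟨ +-cong (dot-⊕ʳ x Mx My) (dot-⊕ʳ y Mx My) ⟩
      (dot xs x Mx + dot xs x My) + (dot xs y Mx + dot xs y My)
        ≈⟨ +-congʳ (+-congˡ (trans (mul-selfAdjoint M-sym x y) (dot-comm Mx y))) ⟩
      (dot xs x Mx + dot xs y Mx) + (dot xs y Mx + dot xs y My)   ≈⟨ +-assoc _ _ _ ⟨
      dot xs x Mx + dot xs y Mx + dot xs y Mx + dot xs y My ∎
      where open ≈-Reasoning
            Mx = mul xs M x
            My = mul xs M y

    quad-⊙ : ∀ M c x → quad xs M (c ⊙ x) ≈ c * c * quad xs M x
    quad-⊙ M c x = begin
      dot xs (c ⊙ x) (mul xs M (c ⊙ x))   ≈⟨ dot-cong (λ _ → refl) (λ {i} _ → mul-⊙ M c x i) ⟩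
      dot xs (c ⊙ x) (c ⊙ mul xs M x)     ≈⟨ dot-⊙ˡ c x _ ⟩
      c * dot xs x (c ⊙ mul xs M x)       ≈⟨ *-congˡ (dot-⊙ʳ c x _) ⟩
      c * (c * quad xs M x)               ≈⟨ *-assoc _ _ _ ⟨
      c * c * quad xs M x ∎
      where open ≈-Reasoning

    -- Semidefinite forms: kernels, elimination, coercivity

    PositiveSemidefinite : Matrixᴵ → Set
    PositiveSemidefinite M = ∀ x → 0# ≤ quad xs M x

    -- Compare M with the identity: q(t x + M x) is nonnegative for every t, and its t-coefficient is 2 |M x|².
    isotropic⇒kernel : ∀ {M} → Symmetric M → PositiveSemidefinite M → ∀ {x} → quad xs M x ≈ 0# →
                       ∀ {i} → i ∈ xs → mul xs M x i ≈ 0#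
    isotropic⇒kernel {M} M-sym M-psd {x} qx≈0 = dot-self≈0 {y} |y|²≈0
      where
      y = mul xs M x
      n = dot xs y y
      quad-line : ∀ t → 0# ≤ (t + t) * n + quad xs M y
      quad-line t = ≤-respʳ-≈ eq (M-psd (t ⊙ x ⊕ y))
        where
        t·y : dot xs y (mul xs M (t ⊙ x)) ≈ t * n
        t·y = trans (dot-cong (λ _ → refl) (λ {i} _ → mul-⊙ M t x i)) (dot-⊙ʳ t y y)
        eq : quad xs M (t ⊙ x ⊕ y) ≈ (t + t) * n + quad xs M y
        eq = trans (quad-⊕ M-sym (t ⊙ x) y)
          (trans (+-congʳ (+-cong (+-cong (trans (quad-⊙ M t x) (trans (*-congˡ qx≈0) (zeroʳ _))) t·y) t·y))
            (solve 3 (λ t n q → con (+ 0) :+ t :* n :+ t :* n :+ q := (t :+ t) :* n :+ q) refl t n (quad xs M y)))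
      |y|²≈0 : n ≈ 0#
      |y|²≈0 with n ≈? 0#
      ... | yes n≈0 = n≈0
      ... | no  n≉0 with m , nm≈1 ← inverse n n≉0 = contradiction 1≤0 1≰0
        where
        q = quad xs M y
        0≤q = M-psd y
        -- As `n * m` is one, this choice gives `(t + t) * n + q` the value -2 - q, which is
        -- negative because `q` is nonnegative.
        t = - (m * (1# + q))
        1≤0 : 1# ≤ 0#
        1≤0 = ≤-by _ (+-nonneg (+-nonneg (quad-line t) 0≤q) 0≤1)
          (trans (solve 3 (λ m n q → con (+ 1) :+ (((:- (m :* (con (+ 1) :+ q))) :+ (:- (m :* (con (+ 1) :+ q)))) :* n :+ q :+ q :+ con (+ 1))
                            := (con (+ 1) :+ con (+ 1)) :* (con (+ 1) :+ q) :* (con (+ 1) :- n :* m)) refl m n q)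
            (trans (*-congˡ (trans (+-congˡ (-‿cong nm≈1)) (-‿inverseʳ 1#))) (zeroʳ _)))

  -- A Cauchy-Schwarz inequality with a wasteful constant. Since any finite constant suffices, the
  -- estimate (aw + l)² ≤ 2a²w² + 2l² gives a direct induction on the list.
  form-bound : ∀ {I : Set} (xs : List I) c → ∃ λ C → 0# ≤ C ×
               (∀ v → dot xs c v * dot xs c v ≤ C * dot xs v v)
  form-bound []       c = 0# , ≤-refl , λ v → ≤-refl
  form-bound (x ∷ xs) c with C , 0≤C , bound ← form-bound xs c =
    (c x * c x + c x * c x) + (C + C) , +-nonneg (+-nonneg (0≤x² _) (0≤x² _)) (+-nonneg 0≤C 0≤C) ,
    λ v → let a = c x ; w = v x ; l = dot xs c v ; Y = dot xs v v
              0≤CY-l² = ≤⇒0≤ (bound v)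
              0≤a²Y = *-nonneg _ _ (0≤x² a) (dot-self-nonneg xs v)
              0≤Cw² = *-nonneg _ _ 0≤C (0≤x² w) in
      ≤-by ((a * w - l) * (a * w - l) + (C * Y - l * l) + (C * Y - l * l)
              + (a * a * Y + a * a * Y) + (C * (w * w) + C * (w * w)))
           (+-nonneg (+-nonneg (+-nonneg (+-nonneg (0≤x² _) 0≤CY-l²) 0≤CY-l²) (+-nonneg 0≤a²Y 0≤a²Y)) (+-nonneg 0≤Cw² 0≤Cw²))
           (solve 5 (λ a w l Y C →
             (a :* w :+ l) :* (a :* w :+ l) :+
               ((a :* w :- l) :* (a :* w :- l) :+ (C :* Y :- l :* l) :+ (C :* Y :- l :* l)
                 :+ (a :* a :* Y :+ a :* a :* Y) :+ (C :* (w :* w) :+ C :* (w :* w)))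
             := (a :* a :+ a :* a :+ (C :+ C)) :* (w :* w :+ Y)) refl a w l Y C)

  module _ {I : Set} where

    quad-∷ : ∀ x (xs : List I) {B} → Symmetric B → ∀ v →
             quad (x ∷ xs) B v ≈
             B x x * (v x * v x) + (v x * dot xs (B x) v + v x * dot xs (B x) v) + quad xs B v
    quad-∷ x xs {B} B-sym v = begin
      v x * (B x x * v x + r) + ∑ xs (λ i → v i * (B i x * v x + mul xs B v i))
        ≈⟨ +-congˡ (∑-cong xs λ i → trans (*-congˡ (+-congʳ (*-congʳ (B-sym i x))))
             (solve 4 (λ w b u m → w :* (b :* u :+ m) := u :* (b :* w) :+ w :* m)
                   refl (v i) (B x i) (v x) (mul xs B v i))) ⟩
      v x * (B x x * v x + r) + ∑ xs (λ i → v x * (B x i * v i) + v i * mul xs B v i)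
        ≈⟨ +-congˡ (trans (∑-+ xs _ _) (+-congʳ (∑-*ˡ xs (v x) _))) ⟩
      v x * (B x x * v x + r) + (v x * r + quad xs B v)
        ≈⟨ solve 4 (λ u b r q → u :* (b :* u :+ r) :+ (u :* r :+ q) := b :* (u :* u) :+ (u :* r :+ u :* r) :+ q)
             refl (v x) (B x x) r (quad xs B v) ⟩
      B x x * (v x * v x) + (v x * r + v x * r) + quad xs B v ∎
      where open ≈-Reasoning
            r = dot xs (B x) v

    -- When `b` is a pivot of `B` and `c` its row divided by `b`, this is the Schur complement: the
    -- form that remains after eliminating one coordinate.
    rankOneUpdate : Matrixᴵ → Carrier → Vector → Matrixᴵ {I}
    rankOneUpdate B b c i j = B i j - b * (c i * c j)

    quad-rankOneUpdate : ∀ xs B b c v →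
      quad xs (rankOneUpdate B b c) v ≈ quad xs B v - b * (dot xs c v * dot xs c v)
    quad-rankOneUpdate xs B b c v = begin
      ∑ xs (λ i → v i * ∑ xs (λ j → (B i j - b * (c i * c j)) * v j))
        ≈⟨ ∑-cong xs (λ i → trans (*-congˡ (row i)) (distribˡ _ _ _)) ⟩
      ∑ xs (λ i → v i * mul xs B v i + v i * (- (b * c i) * l))
        ≈⟨ ∑-+ xs _ _ ⟩
      quad xs B v + ∑ xs (λ i → v i * (- (b * c i) * l))
        ≈⟨ +-congˡ (trans (∑-cong xs (λ i →
             solve 4 (λ w b c l → w :* ((:- (b :* c)) :* l) := (:- (b :* l)) :* (c :* w)) refl (v i) b (c i) l))
             (∑-*ˡ xs (- (b * l)) _)) ⟩
      quad xs B v + - (b * l) * l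
        ≈⟨ solve 3 (λ q b l → q :+ (:- (b :* l)) :* l := q :- b :* (l :* l)) refl (quad xs B v) b l ⟩
      quad xs B v - b * (l * l) ∎
      where
      open ≈-Reasoning
      l = dot xs c v
      row : ∀ i → ∑ xs (λ j → (B i j - b * (c i * c j)) * v j) ≈ mul xs B v i + - (b * c i) * l
      row i = trans (∑-cong xs λ j →
        solve 5 (λ m b c d w → (m :- b :* (c :* d)) :* w := m :* w :+ (:- (b :* c)) :* (d :* w))
          refl (B i j) b (c i) (c j) (v j))
        (trans (∑-+ xs _ _) (+-congˡ (∑-*ˡ xs (- (b * c i)) _)))

  module _ {I : Set} (_≟_ : DecidableEquality I) where

    set : Vector → I → Carrier → Vector
    set v x c y = if does (y ≟ x) then c else v y

    set-same : ∀ v x c → set v x c x ≈ c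
    set-same v x c with x ≟ x
    ... | yes _   = refl
    ... | no  x≢x = contradiction ≡.refl x≢x

    set-other : ∀ v x c {xs} → All (x ≢_) xs → ∀ {y} → y ∈ xs → set v x c y ≈ v y
    set-other v x c x∉xs {y} y∈xs with y ≟ x
    ... | yes ≡.refl = contradiction ≡.refl (All.lookup x∉xs y∈xs)
    ... | no  _   = refl

    basis : I → Vector
    basis x = set (λ _ → 0#) x 1#

    basis-∉ : ∀ x {xs} → All (x ≢_) xs → ∀ {y} → y ∈ xs → basis x y ≈ 0#
    basis-∉ x = set-other (λ _ → 0#) x 1#

    dot-basis : ∀ {x xs} → All (x ≢_) xs → ∀ v → dot xs v (basis x) ≈ 0#
    dot-basis {x} {xs} x∉xs v = ∑-zero xs (λ y∈ → trans (*-congˡ (basis-∉ x x∉xs y∈)) (zeroʳ _))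

    dot-basis-self : ∀ {x xs} → All (x ≢_) xs → dot (x ∷ xs) (basis x) (basis x) ≈ 1#
    dot-basis-self {x} x∉xs = trans
      (+-cong (trans (*-cong e-x e-x) (*-identityˡ 1#)) (dot-basis x∉xs (basis x))) (+-identityʳ 1#)
      where e-x = set-same (λ _ → 0#) x 1#

    quad-basis : ∀ {x xs} → All (x ≢_) xs → ∀ {B} → Symmetric B → quad (x ∷ xs) B (basis x) ≈ B x x
    quad-basis {x} {xs} x∉xs {B} B-sym = trans (quad-∷ x xs B-sym (basis x))
      (trans (+-cong (+-cong (*-congˡ (*-cong e-x e-x)) (+-cong er≈0 er≈0))
          (∑-zero xs (λ y∈ → trans (*-congʳ (basis-∉ x x∉xs y∈)) (zeroˡ _))))
        (solve 1 (λ b → b :* (con (+ 1) :* con (+ 1)) :+ (con (+ 0) :+ con (+ 0)) :+ con (+ 0) := b) refl (B x x)))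
      where
      e-x = set-same (λ _ → 0#) x 1#
      er≈0 : basis x x * dot xs (B x) (basis x) ≈ 0#
      er≈0 = trans (*-congˡ (dot-basis x∉xs (B x))) (zeroʳ _)

    -- Nonvanishing is measured by `dot`, because elimination shrinks `xs` and the form sees only
    -- the entries listed there.
    IsotropicVector : List I → Matrixᴵ → Set
    IsotropicVector xs B = ∃ λ v → ¬ (dot xs v v ≈ 0#) × quad xs B v ≈ 0#

    Coercive : List I → Matrixᴵ → Set
    Coercive xs B = ∃ λ K → 0# ≤ K × (∀ v → dot xs v v ≤ K * quad xs B v)

    -- Gaussian elimination: with c = B x / B x x the form splits as B x x (v x + c·v)² plus the Schur complement.
    isotropic-or-coercive : ∀ {xs} → Unique xs → ∀ {B} → Symmetric B → PositiveSemidefinite xs B →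
                            IsotropicVector xs B ⊎ Coercive xs B
    isotropic-or-coercive [] B-sym B-psd = inj₂ (0# , ≤-refl , λ v → ≤-reflexive (sym (zeroˡ _)))
    isotropic-or-coercive {x ∷ xs} (x∉xs ∷ xs!) {B} B-sym B-psd with B x x ≈? 0#
    ... | yes b≈0 = inj₁ (basis x , (λ e·e≈0 → 0≉1 (trans (sym e·e≈0) (dot-basis-self x∉xs))) ,
                          trans (quad-basis x∉xs B-sym) b≈0)
    ... | no b≉0 with β , bβ≈1 ← inverse (B x x) b≉0 =
      [ inj₁ ∘ isotropic , inj₂ ∘ coercive ]′ (isotropic-or-coercive xs! B′-sym B′-psd)
      where
      b = B x x
      c : Vector
      c i = β * B x i
      B′ : Matrixᴵ
      B′ = rankOneUpdate B b c
      lin : Vector → Carrier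
      lin v = dot xs c v
      r≈b*lin : ∀ v → dot xs (B x) v ≈ b * lin v
      r≈b*lin v = trans (sym (trans (*-congʳ bβ≈1) (*-identityˡ _))) (trans (*-assoc _ _ _) (*-congˡ (sym
        (trans (∑-cong xs (λ j → *-assoc _ _ _)) (∑-*ˡ xs β _)))))
      B′-sym : Symmetric B′
      B′-sym i j = +-cong (B-sym i j) (-‿cong (*-congˡ (*-comm _ _)))
      split : ∀ v → quad (x ∷ xs) B v ≈ b * ((v x + lin v) * (v x + lin v)) + quad xs B′ v
      split v = trans (quad-∷ x xs B-sym v) (trans (+-congʳ (+-congˡ (+-cong (*-congˡ (r≈b*lin v)) (*-congˡ (r≈b*lin v)))))
        (trans (solve 4 (λ b u l q → b :* (u :* u) :+ (u :* (b :* l) :+ u :* (b :* l)) :+ q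
                            := b :* ((u :+ l) :* (u :+ l)) :+ (q :- b :* (l :* l))) refl b (v x) (lin v) (quad xs B v))
          (+-congˡ (sym (quad-rankOneUpdate xs B b c v)))))
      -- The new coordinate is chosen to make the square vanish, so the full form at `lift v` equals
      -- the Schur complement at `v`. Semidefiniteness passes down along `lift`, and isotropic
      -- vectors pass up.
      lift : Vector → Vector
      lift v = set v x (- lin v)
      lift-xs : ∀ v {y} → y ∈ xs → lift v y ≈ v y
      lift-xs v = set-other v x (- lin v) x∉xs
      quad-lift : ∀ v → quad (x ∷ xs) B (lift v) ≈ quad xs B′ v
      quad-lift v = trans (split (lift v)) (trans (+-cong (*-congˡ (*-congˡ z≈0)) (quad-cong xs B′ (lift-xs v)))
        (trans (+-congʳ (trans (*-congˡ (zeroʳ _)) (zeroʳ _))) (+-identityˡ _)))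
        where
        z≈0 : lift v x + lin (lift v) ≈ 0#
        z≈0 = trans (+-cong (set-same v x _) (dot-cong xs (λ _ → refl) (lift-xs v))) (-‿inverseˡ _)
      B′-psd : PositiveSemidefinite xs B′
      B′-psd v = ≤-respʳ-≈ (quad-lift v) (B-psd (lift v))
      isotropic : IsotropicVector xs B′ → IsotropicVector (x ∷ xs) B
      isotropic (v , v≉0 , qv≈0) = lift v , lift≉0 , trans (quad-lift v) qv≈0
        where
        lift≉0 : ¬ (dot (x ∷ xs) (lift v) (lift v) ≈ 0#)
        lift≉0 l·l≈0 = v≉0 (trans (sym (dot-cong xs (lift-xs v) (lift-xs v)))
          (x+y≤0⇒x≈0 (dot-self-nonneg xs (lift v)) (0≤x² (lift v x)) (≤-reflexive (trans (+-comm _ _) l·l≈0))))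
      coercive : Coercive xs B′ → Coercive (x ∷ xs) B
      coercive (K , 0≤K , bound) with C , 0≤C , form≤ ← form-bound xs c =
        K″ , +-nonneg (+-nonneg 0≤β 0≤β) (*-nonneg _ _ 0≤D 0≤K) , bound″
        where
        0≤b : 0# ≤ b
        0≤b = ≤-respʳ-≈ (quad-basis x∉xs B-sym) (B-psd (basis x))
        0≤β = inverse-nonneg 0≤b bβ≈1
        D = C + C + 1#
        0≤D = +-nonneg (+-nonneg 0≤C 0≤C) 0≤1
        -- From u² ≤ 2(u + l)² + 2l², l² ≤ CY and Y ≤ Kq follows u² + Y ≤ 2β · b(u + l)² + (2C + 1)K
        -- · q, where bβ = 1. The sum of the two coefficients bounds both.
        K″ = (β + β) + D * K
        bound″ : ∀ v → dot (x ∷ xs) v v ≤ K″ * quad (x ∷ xs) B v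
        bound″ v = ≤-respʳ-≈ (*-congˡ (sym (split v))) (≤-by d 0≤d
          -- For the solver `β` is a free variable, so the identity carries a remainder with the
          -- factor `1# - b * β`, which `bβ≈1` then removes.
          (trans (solve 8 (λ u l Y q b β C K →
              u :* u :+ Y :+ ((u :+ l :+ l) :* (u :+ l :+ l) :+ (C :* Y :- l :* l) :+ (C :* Y :- l :* l)
                :+ (C :+ C :+ con (+ 1)) :* (K :* q :- Y)
                :+ (β :+ β) :* q :+ (C :+ C :+ con (+ 1)) :* K :* (b :* ((u :+ l) :* (u :+ l))))
              := (β :+ β :+ (C :+ C :+ con (+ 1)) :* K) :* (b :* ((u :+ l) :* (u :+ l)) :+ q)
                 :+ (con (+ 1) :+ con (+ 1)) :* (con (+ 1) :- b :* β) :* ((u :+ l) :* (u :+ l)))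
              refl u l Y q b β C K)
            (trans (+-congˡ (trans (*-congʳ (trans (*-congˡ (trans (+-congˡ (-‿cong bβ≈1)) (-‿inverseʳ 1#))) (zeroʳ _))) (zeroˡ _))) (+-identityʳ _))))
          where
          u = v x
          l = lin v
          Y = dot xs v v
          q = quad xs B′ v
          d = (u + l + l) * (u + l + l) + (C * Y - l * l) + (C * Y - l * l)
                + (C + C + 1#) * (K * q - Y) + (β + β) * q + (C + C + 1#) * K * (b * ((u + l) * (u + l)))
          0≤d : 0# ≤ d
          0≤d = +-nonneg (+-nonneg (+-nonneg (+-nonneg (+-nonneg (0≤x² _) (≤⇒0≤ (form≤ v))) (≤⇒0≤ (form≤ v)))
            (*-nonneg _ _ 0≤D (≤⇒0≤ (bound v)))) (*-nonneg _ _ (+-nonneg 0≤β 0≤β) (B′-psd v)))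
            (*-nonneg _ _ (*-nonneg _ _ 0≤D 0≤K) (*-nonneg _ _ 0≤b (0≤x² _)))

  -- Squares and absolute values

  xy≤x²+y² : ∀ x y → x * y ≤ x * x + y * y
  xy≤x²+y² x y with total 0# (x * y)
  ... | inj₁ 0≤xy = ≤-by ((x - y) * (x - y) + x * y) (+-nonneg (0≤x² _) 0≤xy)
    (solve 2 (λ x y → x :* y :+ ((x :- y) :* (x :- y) :+ x :* y) := x :* x :+ y :* y) refl x y)
  ... | inj₂ xy≤0 = ≤-trans xy≤0 (+-nonneg (0≤x² x) (0≤x² y))

  x²≤y²⇒x≤y : ∀ {x y} → 0# ≤ y → x * x ≤ y * y → x ≤ y
  x²≤y²⇒x≤y {x} {y} 0≤y x²≤y² with x ≤? y
  ... | yes x≤y = x≤y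
  ... | no  x≰y = *-cancelˡ-≤ x (λ x≤0 → x≰y (≤-trans x≤0 0≤y))
    (≤-trans x²≤y² (≤-respʳ-≈ (*-comm y x) (*-monoˡ-≤ y 0≤y (≰⇒≥ x≰y))))

  infix 8 ∣_∣ᵃ
  ∣_∣ᵃ : Carrier → Carrier
  ∣ x ∣ᵃ = [ (λ _ → x) , (λ _ → - x) ]′ (total 0# x)

  ∣x∣²≈x² : ∀ x → ∣ x ∣ᵃ * ∣ x ∣ᵃ ≈ x * x
  ∣x∣²≈x² x with total 0# x
  ... | inj₁ _ = refl
  ... | inj₂ _ = solve 1 (λ x → (:- x) :* (:- x) := x :* x) refl x

  0≤xy+∣x∣∣y∣ : ∀ x y → 0# ≤ x * y + ∣ x ∣ᵃ * ∣ y ∣ᵃ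
  0≤xy+∣x∣∣y∣ x y with total 0# x | total 0# y
  ... | inj₁ 0≤x | inj₁ 0≤y = +-nonneg (*-nonneg _ _ 0≤x 0≤y) (*-nonneg _ _ 0≤x 0≤y)
  ... | inj₁ _   | inj₂ _   = ≤-reflexive (solve 2 (λ x y → con (+ 0) := x :* y :+ x :* (:- y)) refl x y)
  ... | inj₂ _   | inj₁ _   = ≤-reflexive (solve 2 (λ x y → con (+ 0) := x :* y :+ (:- x) :* y) refl x y)
  ... | inj₂ x≤0 | inj₂ y≤0 = ≤-respʳ-≈ (solve 2 (λ x y → (:- x) :* (:- y) :+ (:- x) :* (:- y) := x :* y :+ (:- x) :* (:- y))
        refl x y)
    (+-nonneg 0≤ 0≤)
    where 0≤ = *-nonneg _ _ (≤0⇒0≤- x≤0) (≤0⇒0≤- y≤0)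

  -- Rayleigh quotients and the largest eigenvalue

  module _ {I : Set} (xs : List I) where

    Eigenvector : Matrixᴵ → Carrier → Vector → Set
    Eigenvector M μ v = (∃ λ i → ¬ (v i ≈ 0#)) × (∀ i → mul xs M v i ≈ μ * v i)

    -- Guarantees that the Rayleigh quotients of `M` have a supremum: x·Mx is at most |x|² + |Mx|²,
    -- and each entry of Mx is a linear form in x.
    quad-bound : ∀ M → ∃ λ C → ∀ x → quad xs M x ≤ C * dot xs x x
    quad-bound M = 1# + ∑ xs C , λ x → begin
      quad xs M x                                            ≤⟨ ∑-mono-≤ xs (λ i → xy≤x²+y² (x i) (mul xs M x i)) ⟩
      ∑ xs (λ i → x i * x i + mul xs M x i * mul xs M x i)   ≈⟨ ∑-+ xs _ _ ⟩
      dot xs x x + ∑ xs (λ i → mul xs M x i * mul xs M x i)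
        ≤⟨ +-mono-≤ ≤-refl (∑-mono-≤ xs (λ i → proj₂ (proj₂ (form-bound xs (M i))) x)) ⟩
      dot xs x x + ∑ xs (λ i → C i * dot xs x x)
        ≈⟨ +-congˡ (trans (∑-cong xs (λ i → *-comm _ _)) (∑-*ˡ xs _ C)) ⟩
      dot xs x x + dot xs x x * ∑ xs C
        ≈⟨ solve 2 (λ d c → d :+ d :* c := (con (+ 1) :+ c) :* d) refl (dot xs x x) (∑ xs C) ⟩
      (1# + ∑ xs C) * dot xs x x ∎
      where
      open ≤-Reasoning
      C : Vector
      C i = proj₁ (form-bound xs (M i))

    dot-self≈0⇒quad≤ : ∀ M ν {x} → dot xs x x ≈ 0# → quad xs M x ≤ ν * dot xs x x
    dot-self≈0⇒quad≤ M ν x·x≈0 = ≤-reflexive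
      (trans (∑-zero xs (λ i∈ → trans (*-congʳ (dot-self≈0 xs x·x≈0 i∈)) (zeroˡ _)))
        (sym (trans (*-congˡ x·x≈0) (zeroʳ ν))))

    nonzero-entry : ∀ v → ¬ (dot xs v v ≈ 0#) → ∃ λ i → ¬ (v i ≈ 0#)
    nonzero-entry v v·v≉0 = [ (λ e → e) , (λ v≈0 → contradiction (∑-zero xs (λ i∈ → trans (*-congʳ (v≈0 i∈)) (zeroˡ _))) v·v≉0) ]′
      (search xs)
      where
      search : ∀ ys → (∃ λ i → ¬ (v i ≈ 0#)) ⊎ (∀ {i} → i ∈ ys → v i ≈ 0#)
      search []       = inj₂ λ ()
      search (y ∷ ys) with v y ≈? 0# | search ys
      ... | no  v≉0 | _        = inj₁ (y , v≉0)
      ... | yes _   | inj₁ e   = inj₁ e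
      ... | yes v≈0 | inj₂ all = inj₂ λ { (here ≡.refl) → v≈0 ; (there i∈) → all i∈ }

    ∑-single : Unique xs → ∀ {i} → i ∈ xs → ∀ f → (∀ j → i ≢ j → f j ≈ 0#) → ∑ xs f ≈ f i
    ∑-single xs! = go xs!
      where
      go : ∀ {xs} → Unique xs → ∀ {i} → i ∈ xs → ∀ f → (∀ j → i ≢ j → f j ≈ 0#) → ∑ xs f ≈ f i
      go {x ∷ xs} (x∉xs ∷ _) (here ≡.refl) f f≈0 =
        trans (+-congˡ (∑-zero xs (λ {j} j∈ → f≈0 j (All.lookup x∉xs j∈)))) (+-identityʳ _)
      go {x ∷ xs} (x∉xs ∷ xs!) (there i∈) f f≈0 =
        trans (+-cong (f≈0 x (λ i≡x → All.lookup x∉xs i∈ (≡.sym i≡x))) (go xs! i∈ f f≈0)) (+-identityˡ _)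

  module _ {I : Set} (_≟_ : DecidableEquality I) {xs : List I}
           (xs! : Unique xs) (complete : ∀ i → i ∈ xs) where

    scalar : Carrier → Matrixᴵ
    scalar s i j = if does (i ≟ j) then s else 0#

    mul-scalar : ∀ s v i → mul xs (scalar s) v i ≈ s * v i
    mul-scalar s v i = trans (∑-single xs xs! (complete i) _ off) diag
      where
      off : ∀ j → i ≢ j → scalar s i j * v j ≈ 0#
      off j i≢j with i ≟ j
      ... | yes i≡j = contradiction i≡j i≢j
      ... | no  _   = zeroˡ _
      diag : scalar s i i * v i ≈ s * v i
      diag with i ≟ i
      ... | yes _   = refl
      ... | no  i≢i = contradiction ≡.refl i≢i

    scalar-sym : ∀ s → Symmetric (scalar s)
    scalar-sym s i j with i ≟ j | j ≟ i
    ... | yes _   | yes _   = refl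
    ... | no  _   | no  _   = refl
    ... | yes i≡j | no  j≢i = contradiction (≡.sym i≡j) j≢i
    ... | no  i≢j | yes j≡i = contradiction (≡.sym j≡i) i≢j

    -- The supremum s of the Rayleigh quotient makes s - M positive semidefinite but not coercive,
    -- so s is an eigenvalue.
    quad≤ν : ∀ {M ν} → Symmetric M → (∀ s v → Eigenvector xs M s v → s ≤ ν) →
             ∀ x → quad xs M x ≤ ν * dot xs x x
    quad≤ν {M} {ν} M-sym eigenvalue≤ν x with dot xs x x ≈? 0#
    ... | yes x·x≈0 = dot-self≈0⇒quad≤ xs M ν x·x≈0
    ... | no x·x≉0 = ≤-trans (quad≤s x) (≤-respˡ-≈ (*-comm _ _) (≤-respʳ-≈ (*-comm _ _)
                       (*-monoˡ-≤ _ (dot-self-nonneg xs x) s≤ν)))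
      where
      -- All numbers below some Rayleigh quotient. Their supremum is that of the quotients
      -- themselves, and the inequality keeps division out of the definition.
      P : Carrier → Set
      P λ′ = ∃ λ x → ¬ (dot xs x x ≈ 0#) × λ′ * dot xs x x ≤ quad xs M x
      dot≰0 : ∀ {x} → ¬ (dot xs x x ≈ 0#) → ¬ (dot xs x x ≤ 0#)
      dot≰0 {x} x·x≉0 x·x≤0 = x·x≉0 (antisym x·x≤0 (dot-self-nonneg xs x))
      cancel-dot : ∀ {x a b} → ¬ (dot xs x x ≈ 0#) → a * dot xs x x ≤ b * dot xs x x → a ≤ b
      cancel-dot x·x≉0 le = *-cancelˡ-≤ _ (dot≰0 x·x≉0) (≤-respˡ-≈ (*-comm _ _) (≤-respʳ-≈ (*-comm _ _) le))
      rayleigh : ∀ {x} → ¬ (dot xs x x ≈ 0#) → ∃ λ ρ → ρ * dot xs x x ≈ quad xs M x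
      rayleigh {x} x·x≉0 with z , xz≈1 ← inverse _ x·x≉0 = quad xs M x * z ,
        trans (*-assoc _ _ _) (trans (*-congˡ (trans (*-comm _ _) xz≈1)) (*-identityʳ _))
      P-member : ∀ {x} → (x·x≉0 : ¬ (dot xs x x ≈ 0#)) → P (proj₁ (rayleigh x·x≉0))
      P-member {x} x·x≉0 = x , x·x≉0 , ≤-reflexive (proj₂ (rayleigh x·x≉0))
      sup = leastUpperBound P (_ , P-member x·x≉0)
        (proj₁ (quad-bound xs M) , λ { λ′ (x , x·x≉0 , le) → cancel-dot x·x≉0 (≤-trans le (proj₂ (quad-bound xs M) x)) })
      s = proj₁ sup
      quad≤s : ∀ x → quad xs M x ≤ s * dot xs x x
      quad≤s x with dot xs x x ≈? 0#
      ... | yes x·x≈0 = dot-self≈0⇒quad≤ xs M s x·x≈0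
      ... | no x·x≉0 = ≤-respˡ-≈ (trans (*-comm _ _) (proj₂ (rayleigh x·x≉0))) (≤-respʳ-≈ (*-comm _ _)
                         (*-monoˡ-≤ _ (dot-self-nonneg xs x) (proj₁ (proj₂ sup) _ (P-member x·x≉0))))
      B : Matrixᴵ
      B i j = scalar s i j - M i j
      B-sym : Symmetric B
      B-sym i j = +-cong (scalar-sym s i j) (-‿cong (M-sym i j))
      mul-B : ∀ v i → mul xs B v i ≈ s * v i - mul xs M v i
      mul-B v i = trans (∑-cong xs (λ j → solve 3 (λ s m v → (s :- m) :* v := s :* v :+ (:- con (+ 1)) :* (m :* v))
        refl (scalar s i j) (M i j) (v j)))
        (trans (∑-+ xs _ _) (+-cong (mul-scalar s v i) (trans (∑-*ˡ xs _ _)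
          (solve 1 (λ m → (:- con (+ 1)) :* m := :- m) refl (mul xs M v i)))))
      quad-B : ∀ v → quad xs B v ≈ s * dot xs v v - quad xs M v
      quad-B v = trans (∑-cong xs (λ i → trans (*-congˡ (mul-B v i))
          (solve 3 (λ s v m → v :* (s :* v :- m) := s :* (v :* v) :+ (:- con (+ 1)) :* (v :* m)) refl s (v i) (mul xs M v i))))
        (trans (∑-+ xs _ _) (+-cong (∑-*ˡ xs _ _) (trans (∑-*ˡ xs _ _)
          (solve 1 (λ m → (:- con (+ 1)) :* m := :- m) refl (quad xs M v)))))
      B-psd : PositiveSemidefinite xs B
      B-psd v = ≤-respʳ-≈ (sym (quad-B v)) (≤⇒0≤ (quad≤s v))
      fromIsotropic : IsotropicVector _≟_ xs B → s ≤ ν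
      fromIsotropic (v , v·v≉0 , qv≈0) = eigenvalue≤ν s v (nonzero-entry xs v v·v≉0 , λ i →
        trans (solve 2 (λ m t → m := t :- (t :- m)) refl (mul xs M v i) (s * v i))
          (trans (+-congˡ (-‿cong (trans (sym (mul-B v i)) (isotropic⇒kernel xs B-sym B-psd qv≈0 (complete i)))))
            (solve 1 (λ t → t :- con (+ 0) := t) refl (s * v i))))
      -- With `ε` the inverse of `K + 1#`, coercivity gives ε|x|² ≤ s|x|² - x·Mx, so `s - ε` would
      -- be a smaller upper bound. Adding one keeps the divisor positive when `K` vanishes.
      fromCoercive : Coercive _≟_ xs B → s ≤ ν
      fromCoercive (K , 0≤K , bound)
        with ε , K′ε≈1 ← inverse (K + 1#) (λ K′≈0 → 1≰0 (≤-by K 0≤K (trans (+-comm _ _) K′≈0))) =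
        contradiction (proj₂ (proj₂ sup) (s - ε) below) (x≰x-ε ε≰0)
        where
        0≤ε = inverse-nonneg (+-nonneg 0≤K 0≤1) K′ε≈1
        ε≰0 : ¬ (ε ≤ 0#)
        ε≰0 ε≤0 = 0≉1 (trans (sym (trans (*-congˡ (antisym ε≤0 0≤ε)) (zeroʳ _))) K′ε≈1)
        quad≤s-ε : ∀ x → quad xs M x ≤ (s - ε) * dot xs x x
        quad≤s-ε x = 0≤⇒≤ (≤-respʳ-≈ eq (≤⇒0≤ (*-monoˡ-≤ ε 0≤ε (≤-trans (bound x) (≤-by _ (B-psd x) refl)))))
          where
          n = dot xs x x
          q = quad xs M x
          b = quad xs B x
          eq : ε * (K * b + b) - ε * n ≈ (s - ε) * n - q
          eq = trans (solve 4 (λ ε K b n → ε :* (K :* b :+ b) :- ε :* n := (K :+ con (+ 1)) :* ε :* b :- ε :* n) refl ε K b n)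
            (trans (+-congʳ (trans (*-congʳ K′ε≈1) (trans (*-identityˡ b) (quad-B x))))
              (solve 4 (λ s n q ε → s :* n :- q :- ε :* n := (s :- ε) :* n :- q) refl s n q ε))
        below : ∀ λ′ → P λ′ → λ′ ≤ s - ε
        below λ′ (x , x·x≉0 , le) = cancel-dot x·x≉0 (≤-trans le (quad≤s-ε x))
      s≤ν : s ≤ ν
      s≤ν = [ fromIsotropic , fromCoercive ]′ (isotropic-or-coercive _≟_ xs! B-sym B-psd)

  -- Growth of the powers of a nonnegative symmetric matrix

  module _ {I : Set} where

    Nonnegative : Matrixᴵ {I} → Set
    Nonnegative M = ∀ i j → 0# ≤ M i j

    ∣_∣ᵛ : Vector {I} → Vector
    ∣ x ∣ᵛ i = ∣ x i ∣ᵃ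

    power : List I → Matrixᴵ → Vector → ℕ → Vector
    power xs M x = fold x (mul xs M)

  module _ {I : Set} (xs : List I) where

    -- The form at `x` is at least minus the form at the vector of absolute values, which has the
    -- same norm. An upper bound `ν` on Rayleigh quotients therefore makes ν + M semidefinite as
    -- well as ν - M.
    quad+quad∣∣ : ∀ {M} → Nonnegative M → ∀ x → 0# ≤ quad xs M x + quad xs M ∣ x ∣ᵛ
    quad+quad∣∣ {M} M≥0 x = ≤-respʳ-≈ (∑-+ xs _ _) (∑-nonneg xs λ i →
      ≤-respʳ-≈ (trans (∑-+ xs _ _) (+-cong (∑-*ˡ xs _ _) (∑-*ˡ xs _ _))) (∑-nonneg xs λ j →
        ≤-respʳ-≈ (solve 5 (λ m x y u v → m :* (x :* y :+ u :* v) := x :* (m :* y) :+ u :* (m :* v)) refl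
                    (M i j) (x i) (x j) ∣ x i ∣ᵃ ∣ x j ∣ᵃ)
          (*-nonneg _ _ (M≥0 i j) (0≤xy+∣x∣∣y∣ (x i) (x j)))))

    -- 2ν (ν² - M²) = (ν - M)(ν + M)(ν - M) + (ν + M)(ν - M)(ν + M), where ν - M and ν + M are positive semidefinite.
    norm-bound : ∀ {M ν} → Symmetric M → Nonnegative M → ¬ (ν ≤ 0#) → (∀ x → quad xs M x ≤ ν * dot xs x x) →
                 ∀ x → dot xs (mul xs M x) (mul xs M x) ≤ (ν * ν) * dot xs x x
    norm-bound {M} {ν} M-sym M≥0 ν≰0 quad≤ x = *-cancelˡ-≤ (ν + ν) ν+ν≰0
      (0≤⇒≤ (≤-respʳ-≈ combine (+-nonneg (upper 1#) (lower (- 1#)))))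
      where
      0≤ν = ≰⇒≥ ν≰0
      ν+ν≰0 : ¬ (ν + ν ≤ 0#)
      ν+ν≰0 ν+ν≤0 = ν≰0 (≤-trans (≤-by ν 0≤ν refl) ν+ν≤0)
      y = mul xs M x
      X = dot xs x x
      D = dot xs x y
      Y = dot xs y y
      Z = quad xs M y
      -- `z 1#` is (ν + M)x, where the form of ν - M is evaluated, and `z (- 1#)` is (ν - M)x, where
      -- the form of ν + M is. These are the two summands of the identity.
      z : Carrier → Vector
      z t = ν ⊙ x ⊕ t ⊙ y
      quad-z : ∀ t → quad xs M (z t) ≈ ν * ν * D + (t * (ν * Y) + t * (ν * Y)) + t * t * Z
      quad-z t = trans (quad-⊕ xs M-sym (ν ⊙ x) (t ⊙ y)) (trans
        (+-cong (+-cong (+-cong (quad-⊙ xs M ν x) mixed) mixed) (quad-⊙ xs M t y)) (+-congʳ (+-assoc _ _ _)))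
        where
        mixed : dot xs (t ⊙ y) (mul xs M (ν ⊙ x)) ≈ t * (ν * Y)
        mixed = trans (dot-cong xs (λ _ → refl) (λ {i} _ → mul-⊙ xs M ν x i))
          (trans (dot-⊙ˡ xs t y _) (*-congˡ (dot-⊙ʳ xs ν y y)))
      dot-z : ∀ t → dot xs (z t) (z t) ≈ ν * ν * X + (t * (ν * D) + t * (ν * D)) + t * t * Y
      dot-z t = begin
        dot xs (z t) (z t)                                  ≈⟨ dot-⊕ˡ xs (ν ⊙ x) (t ⊙ y) (z t) ⟩
        dot xs (ν ⊙ x) (z t) + dot xs (t ⊙ y) (z t)
          ≈⟨ +-cong (trans (dot-⊙ˡ xs ν x _) (*-congˡ (dot-z-right x)))
                                                                      (trans (dot-⊙ˡ xs t y _) (*-congˡ (dot-z-right y))) ⟩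
        ν * (ν * X + t * D) + t * (ν * dot xs y x + t * Y)
          ≈⟨ +-congˡ (*-congˡ (+-congʳ (*-congˡ (dot-comm xs y x)))) ⟩
        ν * (ν * X + t * D) + t * (ν * D + t * Y)
          ≈⟨ solve 5 (λ ν t X D Y → ν :* (ν :* X :+ t :* D) :+ t :* (ν :* D :+ t :* Y)
               := ν :* ν :* X :+ (t :* (ν :* D) :+ t :* (ν :* D)) :+ t :* t :* Y) refl ν t X D Y ⟩
        ν * ν * X + (t * (ν * D) + t * (ν * D)) + t * t * Y ∎
        where
        open ≈-Reasoning
        dot-z-right : ∀ w → dot xs w (z t) ≈ ν * dot xs w x + t * dot xs w y
        dot-z-right w = trans (dot-⊕ʳ xs w (ν ⊙ x) (t ⊙ y)) (+-cong (dot-⊙ʳ xs ν w x) (dot-⊙ʳ xs t w y))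
      upper : ∀ t → 0# ≤ ν * dot xs (z t) (z t) - quad xs M (z t)
      upper t = ≤⇒0≤ (quad≤ (z t))
      lower : ∀ t → 0# ≤ ν * dot xs (z t) (z t) + quad xs M (z t)
      lower t = ≤-respʳ-≈ (trans (+-congʳ (+-congʳ (*-congˡ (dot-∣∣))))
          (solve 3 (λ a q r → a :- q :+ (r :+ q) := a :+ r)
                refl (ν * dot xs (z t) (z t)) (quad xs M ∣ z t ∣ᵛ) (quad xs M (z t))))
        (+-nonneg (≤⇒0≤ (quad≤ ∣ z t ∣ᵛ)) (quad+quad∣∣ M≥0 (z t)))
        where
        dot-∣∣ : dot xs ∣ z t ∣ᵛ ∣ z t ∣ᵛ ≈ dot xs (z t) (z t)
        dot-∣∣ = ∑-cong xs (λ i → ∣x∣²≈x² (z t i))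
      combine : (ν * dot xs (z 1#) (z 1#) - quad xs M (z 1#)) + (ν * dot xs (z (- 1#)) (z (- 1#)) + quad xs M (z (- 1#)))
                ≈ (ν + ν) * (ν * ν * X) - (ν + ν) * Y
      combine = trans (+-cong (+-cong (*-congˡ (dot-z 1#)) (-‿cong (quad-z 1#))) (+-cong (*-congˡ (dot-z (- 1#))) (quad-z (- 1#))))
        (solve 5 (λ ν X D Y Z → let e = con (+ 1); f = :- con (+ 1) in
            (ν :* (ν :* ν :* X :+ (e :* (ν :* D) :+ e :* (ν :* D)) :+ e :* e :* Y)
              :- (ν :* ν :* D :+ (e :* (ν :* Y) :+ e :* (ν :* Y)) :+ e :* e :* Z))
            :+ (ν :* (ν :* ν :* X :+ (f :* (ν :* D) :+ f :* (ν :* D)) :+ f :* f :* Y)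
              :+ (ν :* ν :* D :+ (f :* (ν :* Y) :+ f :* (ν :* Y)) :+ f :* f :* Z))
            := (ν :+ ν) :* (ν :* ν :* X) :- (ν :+ ν) :* Y) refl ν X D Y Z)

    power-norm-bound : ∀ {M ν} → Symmetric M → Nonnegative M → ¬ (ν ≤ 0#) → (∀ x → quad xs M x ≤ ν * dot xs x x) →
                       ∀ x n → dot xs (power xs M x n) (power xs M x n) ≤ (ν * ν) ^ n * dot xs x x
    power-norm-bound M-sym M≥0 ν≰0 quad≤ x zero    = ≤-reflexive (sym (*-identityˡ _))
    power-norm-bound {ν = ν} M-sym M≥0 ν≰0 quad≤ x (suc n) = ≤-trans (norm-bound M-sym M≥0 ν≰0 quad≤ _)
      (≤-respʳ-≈ (sym (*-assoc _ _ _)) (*-monoˡ-≤ (ν * ν) (0≤x² ν) (power-norm-bound M-sym M≥0 ν≰0 quad≤ x n)))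

    power-selfAdjoint : ∀ {M} → Symmetric M → ∀ x y n → dot xs x (power xs M y n) ≈ dot xs (power xs M x n) y
    power-selfAdjoint M-sym x y zero    = refl
    power-selfAdjoint {M} M-sym x y (suc n) = trans (mul-selfAdjoint xs M-sym x (power xs M y n))
      (trans (power-selfAdjoint M-sym (mul xs M x) y n) (dot-cong xs (λ {i} _ → shift n i) (λ _ → refl)))
      where
      shift : ∀ n i → power xs M (mul xs M x) n i ≈ power xs M x (suc n) i
      shift zero    i = refl
      shift (suc n) i = mul-cong xs M (λ {j} _ → shift n j) i

    power-nonneg : ∀ {M} → Nonnegative M → ∀ {x} → (∀ i → 0# ≤ x i) → ∀ n i → 0# ≤ power xs M x n i
    power-nonneg M≥0 x≥0 zero    i = x≥0 i
    power-nonneg M≥0 x≥0 (suc n) i = ∑-nonneg xs (λ j → *-nonneg _ _ (M≥0 i j) (power-nonneg M≥0 x≥0 n j))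

    -- A nonnegative matrix preserves entrywise domination, and on `v` it acts as `μ`. The free
    -- factor `c` lets one application be chained after another, as an iterated power requires.
    power-lower-bound : ∀ {M μ v} → Nonnegative M → (∀ i → mul xs M v i ≈ μ * v i) →
      ∀ {c K x} → (∀ i → c * v i ≤ K * x i) → ∀ n i → μ ^ n * c * v i ≤ K * power xs M x n i
    power-lower-bound M≥0 Mv≈μv cv≤Kx zero i = ≤-respˡ-≈ (*-congʳ (sym (*-identityˡ _))) (cv≤Kx i)
    power-lower-bound {M} {μ} {v} M≥0 Mv≈μv {c} {K} {x} cv≤Kx (suc n) i = begin
      μ * μ ^ n * c * v i
        ≈⟨ solve 4 (λ μ p c v → μ :* p :* c :* v := p :* c :* (μ :* v)) refl μ (μ ^ n) c (v i) ⟩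
      μ ^ n * c * (μ * v i)                        ≈⟨ *-congˡ (Mv≈μv i) ⟨
      μ ^ n * c * mul xs M v i                     ≈⟨ mul-⊙ xs M (μ ^ n * c) v i ⟨
      mul xs M ((μ ^ n * c) ⊙ v) i
        ≤⟨ ∑-mono-≤ xs (λ j → *-monoˡ-≤ (M i j) (M≥0 i j) (power-lower-bound M≥0 Mv≈μv cv≤Kx n j)) ⟩
      mul xs M (K ⊙ power xs M x n) i              ≈⟨ mul-⊙ xs M K _ i ⟩
      K * mul xs M (power xs M x n) i              ∎
      where open ≤-Reasoning

  𝟙 : {I : Set} → Vector {I}
  𝟙 _ = 1#

  x≰0∨-x≰0 : ∀ {x} → ¬ (x ≈ 0#) → ¬ (x ≤ 0#) ⊎ ¬ (- x ≤ 0#)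
  x≰0∨-x≰0 {x} x≉0 with x ≤? 0#
  ... | no  x≰0 = inj₁ x≰0
  ... | yes x≤0 = inj₂ λ -x≤0 → x≉0 (antisym x≤0
          (≤-respʳ-≈ (solve 1 (λ x → :- (:- x) := x) refl x) (≤0⇒0≤- -x≤0)))

  module _ {I J : Set} (xs : List I) (ys : List J) {M : Matrixᴵ {I}} {N : Matrixᴵ {J}} where

    -- The mass Σ M²ⁿ𝟙 grows at least like μ²ⁿ and Σ N²ⁿ𝟙 at most like ν²ⁿ.
    eigenvalue≤ : (∀ i → i ∈ xs) → Nonnegative M → Symmetric N → Nonnegative N →
      (∀ n → ∑ xs (power xs M (power xs M 𝟙 n) n) ≤ ∑ ys (power ys N (power ys N 𝟙 n) n)) →
      ∀ {μ v ν} → Eigenvector xs M μ v → (∀ y → quad ys N y ≤ ν * dot ys y y) → μ ≤ ν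
    eigenvalue≤ complete M≥0 N-sym N≥0 mass≤ {μ} {v} {ν} ((i , vi≉0) , Mv≈μv) quad≤ with μ ≤? ν
    ... | yes μ≤ν = μ≤ν
    ... | no  μ≰ν = contradiction (μ≤ν′⇒μ≤ν (x²≤y²⇒x≤y 0≤ν′ μ²≤ν′²)) μ≰ν
      where
      ν≤μ = ≰⇒≥ μ≰ν
      -- The number of indices in `ys`. The hypothesis with exponent zero compares the two index
      -- counts, and `xs` contains `i`, so `ys` is nonempty; testing the form on `𝟙` then shows that
      -- `ν` is nonnegative.
      D = ∑ ys (λ _ → 1# * 1#)
      1≤D : 1# ≤ D
      1≤D = ≤-trans (term≤∑ (λ _ → 0≤1) (complete i)) (≤-trans (mass≤ 0) (∑-mono-≤ ys (λ _ → ≤-reflexive (sym (*-identityˡ 1#)))))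
      D≰0 : ¬ (D ≤ 0#)
      D≰0 D≤0 = 1≰0 (≤-trans 1≤D D≤0)
      0≤ν : 0# ≤ ν
      0≤ν = *-cancelˡ-≤ D D≰0 (≤-respˡ-≈ (sym (zeroʳ D)) (≤-respʳ-≈ (*-comm ν D)
        (≤-trans (∑-nonneg ys (λ i → *-nonneg _ _ 0≤1 (∑-nonneg ys (λ j → *-nonneg _ _ (N≥0 i j) 0≤1)))) (quad≤ 𝟙))))
      -- The growth estimates need a positive bound, while `ν` itself may be zero. As `μ` exceeds
      -- `ν` here, the midpoint is positive, and `μ ≤ ν′` already contradicts `μ≰ν`.
      ν′ = ½ * (ν + μ)
      ν≤ν′ : ν ≤ ν′
      ν≤ν′ = *-cancelˡ-≤ (1# + 1#) 2≰0 (≤-respˡ-≈ (x+x≈2x ν) (≤-respʳ-≈ (sym 2ν′≈ν+μ) (+-mono-≤ ≤-refl ν≤μ)))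
        where
        2ν′≈ν+μ : (1# + 1#) * ν′ ≈ ν + μ
        2ν′≈ν+μ = trans (sym (x+x≈2x ν′)) (double-halve (ν + μ))
      0≤ν′ = ≤-trans 0≤ν ν≤ν′
      μ≤ν′⇒μ≤ν : μ ≤ ν′ → μ ≤ ν
      μ≤ν′⇒μ≤ν μ≤ν′ = 0≤⇒≤ (≤-respʳ-≈ eq (+-nonneg (≤⇒0≤ μ≤ν′) (≤⇒0≤ μ≤ν′)))
        where
        eq : ν′ - μ + (ν′ - μ) ≈ ν - μ
        eq = trans (solve 2 (λ n m → n :- m :+ (n :- m) := n :+ n :- (m :+ m)) refl ν′ μ)
          (trans (+-congʳ (double-halve (ν + μ))) (solve 2 (λ n m → n :+ m :- (m :+ m) := n :- m) refl ν μ))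
      ν′≰0 : ¬ (ν′ ≤ 0#)
      ν′≰0 ν′≤0 = μ≰ν (≤-trans (≤-by ν 0≤ν (trans (+-comm μ ν) ν+μ≈0)) 0≤ν)
        where
        ν+μ≈0 : ν + μ ≈ 0#
        ν+μ≈0 = trans (sym (double-halve (ν + μ))) (trans (+-cong ν′≈0 ν′≈0) (+-identityˡ 0#))
          where ν′≈0 = antisym ν′≤0 0≤ν′
      quad≤′ : ∀ y → quad ys N y ≤ ν′ * dot ys y y
      quad≤′ y = ≤-trans (quad≤ y) (≤-respˡ-≈ (*-comm _ _) (≤-respʳ-≈ (*-comm _ _) (*-monoˡ-≤ _ (dot-self-nonneg ys y) ν≤ν′)))
      bound : ∀ u → (∀ i → mul xs M u i ≈ μ * u i) → ¬ (u i ≤ 0#) → μ * μ ≤ ν′ * ν′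
      bound u Mu≈μu ui≰0 = dominated-powers⇒≤ (0≤x² μ) (λ ν′²≤0 → ν′≰0 (≤-reflexive (x²≈0⇒x≈0 (antisym ν′²≤0 (0≤x² ν′))))) ui≰0
        λ n → begin
        (μ * μ) ^ n * u i                               ≈⟨ *-congʳ (*-^ μ μ n) ⟩
        μ ^ n * μ ^ n * u i                             ≈⟨ *-congʳ (*-congˡ (*-identityʳ _)) ⟨
        μ ^ n * (μ ^ n * 1#) * u i
          ≤⟨ power-lower-bound xs M≥0 Mu≈μu (power-lower-bound xs M≥0 Mu≈μu u≤K n) n i ⟩
        K * power xs M (power xs M 𝟙 n) n i
          ≤⟨ *-monoˡ-≤ K 0≤K (term≤∑ (power-nonneg xs M≥0 (power-nonneg xs M≥0 (λ _ → 0≤1) n) n) (complete i)) ⟩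
        K * ∑ xs (power xs M (power xs M 𝟙 n) n)        ≤⟨ *-monoˡ-≤ K 0≤K (mass≤ n) ⟩
        K * ∑ ys (power ys N (power ys N 𝟙 n) n)        ≈⟨ *-congˡ (∑-cong ys (λ _ → *-identityˡ _)) ⟨
        K * dot ys 𝟙 (power ys N (power ys N 𝟙 n) n)    ≈⟨ *-congˡ (power-selfAdjoint ys N-sym 𝟙 _ n) ⟩
        K * dot ys (power ys N 𝟙 n) (power ys N 𝟙 n)
          ≤⟨ *-monoˡ-≤ K 0≤K (power-norm-bound ys N-sym N≥0 ν′≰0 quad≤′ 𝟙 n) ⟩
        K * ((ν′ * ν′) ^ n * D)
          ≈⟨ solve 3 (λ k p d → k :* (p :* d) := p :* (k :* d)) refl K _ D ⟩
        (ν′ * ν′) ^ n * (K * D)                         ∎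
        where
        open ≤-Reasoning
        -- A constant dominating every entry: `u j` is at most its square plus one.
        K = dot xs u u + 1#
        0≤K : 0# ≤ K
        0≤K = +-nonneg (dot-self-nonneg xs u) 0≤1
        u≤K : ∀ j → 1# * u j ≤ K * 1#
        u≤K j = begin
          1# * u j            ≈⟨ *-comm _ _ ⟩
          u j * 1#            ≤⟨ xy≤x²+y² (u j) 1# ⟩
          u j * u j + 1# * 1# ≤⟨ +-mono-≤ (term≤∑ (λ j → 0≤x² (u j)) (complete j)) (≤-reflexive (*-identityˡ 1#)) ⟩
          K                   ≈⟨ *-identityʳ K ⟨
          K * 1#              ∎
      μ²≤ν′² : μ * μ ≤ ν′ * ν′
      -- The eigenvector may have any signs, but its nonzero entry at `i` is positive in `v` or in
      -- its negative, and one positive entry is all that `bound` needs.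
      μ²≤ν′² = [ bound v Mv≈μv , bound ((- 1#) ⊙ v) M-v ∘ (λ -v≰0 le → -v≰0 (≤-respˡ-≈ (neg (v i)) le)) ]′ (x≰0∨-x≰0 vi≉0)
        where
        neg : ∀ x → (- 1#) * x ≈ - x
        neg = solve 1 (λ x → (:- con (+ 1)) :* x := :- x) refl
        M-v : ∀ j → mul xs M ((- 1#) ⊙ v) j ≈ μ * ((- 1#) * v j)
        M-v j = trans (mul-⊙ xs M (- 1#) v j) (trans (*-congˡ (Mv≈μv j))
          (solve 2 (λ μ x → (:- con (+ 1)) :* (μ :* x) := μ :* ((:- con (+ 1)) :* x)) refl μ (v j)))

-- Subsets, symmetric differences and two-element subsets

module Subsets where

  open import Data.Nat.Base using (_+_)
  open ≡ using (refl; sym; trans; subst; module ≡-Reasoning)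

  KSubset-≡ : ∀ {n k} {S T : KSubset n k} → proj₁ S ≡ proj₁ T → S ≡ T
  KSubset-≡ {S = S , p} {.S , q} refl = cong (S ,_) (ℕₚ.≡-irrelevant p q)

  _≟ˢ_ : ∀ {n} → DecidableEquality (Subset n)
  _≟ˢ_ = ≡-dec _≟ᵇ_

  _≟ᵏ_ : ∀ {n k} → DecidableEquality (KSubset n k)
  S ≟ᵏ T with proj₁ S ≟ˢ proj₁ T
  ... | yes p = yes (KSubset-≡ p)
  ... | no ¬p = no (¬p ∘ cong proj₁)

  insideᵏ-injective : ∀ {n k} {S T : KSubset n k} → insideᵏ S ≡ insideᵏ T → S ≡ T
  insideᵏ-injective eq with refl ← cong proj₁ eq = KSubset-≡ refl

  outsideᵏ-injective : ∀ {n k} {S T : KSubset n k} → outsideᵏ S ≡ outsideᵏ T → S ≡ T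
  outsideᵏ-injective eq with refl ← cong proj₁ eq = KSubset-≡ refl

  kSubsets-unique : ∀ n k → Unique (kSubsets n k)
  kSubsets-unique zero    zero    = [] ∷ []
  kSubsets-unique zero    (suc k) = []
  kSubsets-unique (suc n) zero    = Unique.map⁺ outsideᵏ-injective (kSubsets-unique n zero)
  kSubsets-unique (suc n) (suc k) = Unique.++⁺
    (Unique.map⁺ insideᵏ-injective (kSubsets-unique n k))
    (Unique.map⁺ outsideᵏ-injective (kSubsets-unique n (suc k)))
    disjoint
    where
    disjoint : ∀ {S} → ¬ (S ∈ map insideᵏ (kSubsets n k) × S ∈ map outsideᵏ (kSubsets n (suc k)))
    disjoint (S∈₁ , S∈₂) with _ , _ , refl ← ∈-map⁻ insideᵏ S∈₁ with ∈-map⁻ outsideᵏ S∈₂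
    ... | _ , _ , ()

  kSubsets-complete : ∀ n k S → S ∈ kSubsets n k
  kSubsets-complete zero    zero    ([] , refl) = here refl
  kSubsets-complete (suc n) zero    (outside ∷ S , p) =
    subst (_∈ map outsideᵏ (kSubsets n zero)) (KSubset-≡ refl) (∈-map⁺ outsideᵏ (kSubsets-complete n zero (S , p)))
  kSubsets-complete (suc n) (suc k) (inside ∷ S , p) =
    ∈-++⁺ˡ (subst (_∈ map insideᵏ (kSubsets n k)) (KSubset-≡ refl) (∈-map⁺ insideᵏ (kSubsets-complete n k (S , ℕₚ.suc-injective p))))
  kSubsets-complete (suc n) (suc k) (outside ∷ S , p) =
    ∈-++⁺ʳ _ (subst (_∈ map outsideᵏ (kSubsets n (suc k))) (KSubset-≡ refl) (∈-map⁺ outsideᵏ (kSubsets-complete n (suc k) (S , p))))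

  △≡xor : ∀ {n} (S T : Subset n) → S △ T ≡ zipWith _xor_ S T
  △≡xor []          []          = refl
  △≡xor (true  ∷ S) (true  ∷ T) = cong (false ∷_) (△≡xor S T)
  △≡xor (true  ∷ S) (false ∷ T) = cong (true  ∷_) (△≡xor S T)
  △≡xor (false ∷ S) (true  ∷ T) = cong (true  ∷_) (△≡xor S T)
  △≡xor (false ∷ S) (false ∷ T) = cong (false ∷_) (△≡xor S T)

  △-comm : ∀ {n} (S T : Subset n) → S △ T ≡ T △ S
  △-comm S T = trans (△≡xor S T) (trans (zipWith-comm xor-comm S T) (sym (△≡xor T S)))

  △-cancel : ∀ {n} (S T : Subset n) → S △ (S △ T) ≡ T
  △-cancel S T = trans (△≡xor S (S △ T)) (trans (cong (zipWith _xor_ S) (△≡xor S T)) (cancel S T))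
    where
    cancel : ∀ {n} (S T : Subset n) → zipWith _xor_ S (zipWith _xor_ S T) ≡ T
    cancel []          []          = refl
    cancel (true  ∷ S) (true  ∷ T) = cong (true  ∷_) (cancel S T)
    cancel (true  ∷ S) (false ∷ T) = cong (false ∷_) (cancel S T)
    cancel (false ∷ S) (y     ∷ T) = cong (y     ∷_) (cancel S T)

  lookup-△ : ∀ {n} (S T : Subset n) i → lookup (S △ T) i ≡ lookup S i xor lookup T i
  lookup-△ S T i = trans (cong (λ U → lookup U i) (△≡xor S T)) (lookup-zipWith _xor_ i S T)

  -- Inclusion-exclusion without subtraction. For a two-element `e` it makes meeting `e` in one
  -- vertex equivalent to `S △ e` having the size of `S`.
  ∣△∣ : ∀ {n} (S T : Subset n) → ∣ S △ T ∣ + (∣ S ∩ T ∣ + ∣ S ∩ T ∣) ≡ ∣ S ∣ + ∣ T ∣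
  ∣△∣ []          []          = refl
  ∣△∣ (true  ∷ S) (true  ∷ T) = begin
    d + (suc c + suc c)      ≡⟨ ℕₚ.+-suc d _ ⟩
    suc (d + (c + suc c))    ≡⟨ cong (λ m → suc (d + m)) (ℕₚ.+-suc c c) ⟩
    suc (d + suc (c + c))    ≡⟨ cong suc (ℕₚ.+-suc d _) ⟩
    suc (suc (d + (c + c)))  ≡⟨ cong (λ m → suc (suc m)) (∣△∣ S T) ⟩
    suc (suc (∣ S ∣ + ∣ T ∣)) ≡⟨ cong suc (ℕₚ.+-suc ∣ S ∣ ∣ T ∣) ⟨
    suc (∣ S ∣ + suc ∣ T ∣)  ∎
    where open ≡-Reasoning
          d = ∣ S △ T ∣
          c = ∣ S ∩ T ∣
  ∣△∣ (true  ∷ S) (false ∷ T) = cong suc (∣△∣ S T)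
  ∣△∣ (false ∷ S) (true  ∷ T) = trans (cong suc (∣△∣ S T)) (sym (ℕₚ.+-suc ∣ S ∣ ∣ T ∣))
  ∣△∣ (false ∷ S) (false ∷ T) = ∣△∣ S T

  ∣S△e∣⇒∣S∩e∣ : ∀ {n} {S e : Subset n} → ∣ e ∣ ≡ 2 → ∣ S △ e ∣ ≡ ∣ S ∣ → ∣ S ∩ e ∣ ≡ 1
  ∣S△e∣⇒∣S∩e∣ {S = S} {e} ∣e∣≡2 eq = half _ (ℕₚ.+-cancelˡ-≡ ∣ S ∣ _ _
    (trans (cong (_+ (∣ S ∩ e ∣ + ∣ S ∩ e ∣)) (sym eq)) (trans (∣△∣ S e) (cong (∣ S ∣ +_) ∣e∣≡2))))
    where
    half : ∀ m → m + m ≡ 2 → m ≡ 1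
    half (suc zero)    _  = refl
    half (suc (suc m)) eq with () ← trans (sym (ℕₚ.+-suc m (suc m))) (ℕₚ.suc-injective (ℕₚ.suc-injective eq))

  ∣S∩e∣⇒∣S△e∣ : ∀ {n} {S e : Subset n} → ∣ e ∣ ≡ 2 → ∣ S ∩ e ∣ ≡ 1 → ∣ S △ e ∣ ≡ ∣ S ∣
  ∣S∩e∣⇒∣S△e∣ {S = S} {e} ∣e∣≡2 eq = ℕₚ.+-cancelʳ-≡ 2 _ _
    (trans (cong (λ m → ∣ S △ e ∣ + (m + m)) (sym eq)) (trans (∣△∣ S e) (cong (∣ S ∣ +_) ∣e∣≡2)))

  -- Replaces cardinalities by membership: through `meets` the condition of crossing `e` becomes an
  -- exclusive or of two bits, and the action on indicators reduces to Boolean tables.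
  record IsEdge {n} (e : Subset n) (i j : Fin n) : Set where
    field
      i≢j   : i ≢ j
      i∈e   : lookup e i ≡ true
      j∈e   : lookup e j ≡ true
      v∉e   : ∀ v → v ≢ i → v ≢ j → lookup e v ≡ false
      meets : ∀ S → does (∣ S ∩ e ∣ ℕₚ.≟ 1) ≡ lookup S i xor lookup S j

  IsEdge-sym : ∀ {n} {e : Subset n} {i j} → IsEdge e i j → IsEdge e j i
  IsEdge-sym {i = i} {j} edge = record
    { i≢j = i≢j ∘ sym ; i∈e = j∈e ; j∈e = i∈e ; v∉e = λ v v≢j v≢i → v∉e v v≢i v≢j
    ; meets = λ S → trans (meets S) (xor-comm (lookup S i) (lookup S j)) }
    where open IsEdge edge

  indicator : Bool → ℕ
  indicator b = if b then 1 else 0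

  ∣e∣≡0 : ∀ {n} (e : Subset n) → ∣ e ∣ ≡ 0 → (∀ v → lookup e v ≡ false) × (∀ S → ∣ S ∩ e ∣ ≡ 0)
  ∣e∣≡0 []          _ = (λ ()) , λ { [] → refl }
  ∣e∣≡0 (false ∷ e) p with v∉e , S∩e ← ∣e∣≡0 e p =
    (λ { zero → refl ; (suc v) → v∉e v }) , λ { (true ∷ S) → S∩e S ; (false ∷ S) → S∩e S }

  ∣e∣≡1 : ∀ {n} (e : Subset n) → ∣ e ∣ ≡ 1 → ∃ λ i →
          lookup e i ≡ true × (∀ v → v ≢ i → lookup e v ≡ false) × (∀ S → ∣ S ∩ e ∣ ≡ indicator (lookup S i))
  ∣e∣≡1 (true ∷ e) p with v∉e , S∩e ← ∣e∣≡0 e (ℕₚ.suc-injective p) =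
    zero , refl , (λ { zero v≢i → contradiction refl v≢i ; (suc v) _ → v∉e v }) ,
    λ { (true ∷ S) → cong suc (S∩e S) ; (false ∷ S) → S∩e S }
  ∣e∣≡1 (false ∷ e) p with i , i∈e , v∉e , S∩e ← ∣e∣≡1 e p =
    suc i , i∈e , (λ { zero _ → refl ; (suc v) v≢i → v∉e v (v≢i ∘ cong suc) }) ,
    λ { (true ∷ S) → S∩e S ; (false ∷ S) → S∩e S }

  ∣e∣≡2⇒edge : ∀ {n} (e : Subset n) → ∣ e ∣ ≡ 2 → ∃ λ i → ∃ λ j → IsEdge e i j
  ∣e∣≡2⇒edge (true ∷ e) p with j , j∈e , v∉e , S∩e ← ∣e∣≡1 e (ℕₚ.suc-injective p) = zero , suc j , record
    { i≢j = λ () ; i∈e = refl ; j∈e = j∈e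
    ; v∉e = λ { zero v≢i _ → contradiction refl v≢i ; (suc v) _ v≢j → v∉e v (v≢j ∘ cong suc) }
    ; meets = λ { (x ∷ S) → meets x S } }
    where
    meets : ∀ x S → does (∣ (x ∷ S) ∩ (true ∷ e) ∣ ℕₚ.≟ 1) ≡ x xor lookup S j
    meets true S rewrite S∩e S with lookup S j
    ... | true  = refl
    ... | false = refl
    meets false S rewrite S∩e S with lookup S j
    ... | true  = refl
    ... | false = refl
  ∣e∣≡2⇒edge (false ∷ e) p with i , j , edge ← ∣e∣≡2⇒edge e p = suc i , suc j , record
    { i≢j = λ { refl → i≢j refl } ; i∈e = i∈e ; j∈e = j∈e
    ; v∉e = λ { zero _ _ → refl ; (suc v) v≢i v≢j → v∉e v (v≢i ∘ cong suc) (v≢j ∘ cong suc) }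
    ; meets = λ { (true ∷ S) → meets S ; (false ∷ S) → meets S } }
    where open IsEdge edge

-- Partial matchings and the cone of their indicators

module TokenGraphs (ℝ : CompleteOrderedField) where

  open import Data.Integer.Base using (+_)
  open CompleteOrderedField ℝ hiding (zero)
  open OrderedField ℝ
  open QuadraticForms ℝ
  open Subsets

  ι : Bool → Carrier
  ι b = if b then 1# else 0#

  -- A list of blocks encodes a partial matching. Unmatched vertices are listed too, so that under
  -- `Cover` every vertex occurs exactly once and subsets can be counted block by block.
  data Block (n : ℕ) : Set where
    single : Fin n → Block n
    pair   : Fin n → Fin n → Block n

  module _ {n : ℕ} where

    vertices : Block n → List (Fin n)
    vertices (single a) = a ∷ []
    vertices (pair a b) = a ∷ b ∷ []

    support : List (Block n) → List (Fin n)
    support []      = []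
    support (b ∷ B) = vertices b ++ support B

    holds : Block n → Subset n → Bool
    holds (single a) S = true
    holds (pair a b) S = lookup S a xor lookup S b

    χ : List (Block n) → Subset n → Bool
    χ []      S = true
    χ (b ∷ B) S = holds b S ∧ χ B S

    Cover : List (Block n) → Set
    Cover B = support B ↭ allFin n

    ↭allFin⇒Unique : ∀ {vs : List (Fin n)} → vs ↭ allFin n → Unique vs
    ↭allFin⇒Unique cover = SetoidPermutation.Unique-resp-↭ (≡.setoid (Fin n)) (↭⇒↭ₛ (↭-sym cover)) (Unique.allFin⁺ n)

    χ-local : ∀ B {S T} → (∀ {v} → v ∈ support B → lookup S v ≡ lookup T v) → χ B S ≡ χ B T
    χ-local []             S≡T = ≡.refl
    χ-local (single a ∷ B) S≡T = χ-local B (S≡T ∘ there)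
    χ-local (pair a b ∷ B) S≡T =
      cong₂ _∧_ (cong₂ _xor_ (S≡T (here ≡.refl)) (S≡T (there (here ≡.refl)))) (χ-local B (S≡T ∘ there ∘ there))

    infix 4 _~_
    -- Reordering blocks or flipping a pair changes neither the covered vertices nor the test. Only
    -- these two invariants are kept, enough to bring the blocks that meet an edge to the front.
    record _~_ (B C : List (Block n)) : Set where
      constructor _,_
      field
        support-↭ : support B ↭ support C
        χ-≡       : ∀ S → χ B S ≡ χ C S

    ~-refl : ∀ {B} → B ~ B
    ~-refl = ↭-refl , λ S → ≡.refl

    ~-trans : ∀ {B C D} → B ~ C → C ~ D → B ~ D
    ~-trans (p , f) (q , g) = ↭-trans p q , λ S → ≡.trans (f S) (g S)

    ~-cons : ∀ b {B C} → B ~ C → b ∷ B ~ b ∷ C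
    ~-cons b (p , f) = ++⁺ˡ (vertices b) p , λ S → cong (holds b S ∧_) (f S)

    ~-swap : ∀ b c B → b ∷ c ∷ B ~ c ∷ b ∷ B
    ~-swap b c B = shifts (vertices b) (vertices c) , λ S →
      ≡.trans (≡.sym (∧-assoc (holds b S) (holds c S) (χ B S)))
        (≡.trans (cong (_∧ χ B S) (∧-comm (holds b S) (holds c S))) (∧-assoc (holds c S) (holds b S) (χ B S)))

    ~-flip : ∀ a b B → pair a b ∷ B ~ pair b a ∷ B
    ~-flip a b B = swap a b ↭-refl , λ S → cong (_∧ χ B S) (xor-comm (lookup S a) (lookup S b))

    Extraction : List (Block n) → Fin n → Set
    Extraction B i = ∃ λ R → (B ~ single i ∷ R) ⊎ (∃ λ a → B ~ pair i a ∷ R)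

    Extraction-∷ : ∀ b {B i} → Extraction B i → Extraction (b ∷ B) i
    Extraction-∷ b (R , inj₁ eq)       = b ∷ R , inj₁ (~-trans (~-cons b eq) (~-swap b _ R))
    Extraction-∷ b (R , inj₂ (a , eq)) = b ∷ R , inj₂ (a , ~-trans (~-cons b eq) (~-swap b _ R))

    extract : ∀ B {i} → i ∈ support B → Extraction B i
    extract (single x ∷ B) (here ≡.refl) = B , inj₁ ~-refl
    extract (pair x y ∷ B) (here ≡.refl) = B , inj₂ (y , ~-refl)
    extract (pair x y ∷ B) (there (here ≡.refl)) = B , inj₂ (x , ~-flip x y B)
    extract (single x ∷ B) (there i∈) = Extraction-∷ (single x) (extract B i∈)
    extract (pair x y ∷ B) (there (there i∈)) = Extraction-∷ (pair x y) (extract B i∈)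

    -- Each constructor accepts every function pointwise equal to the intended one, so operators
    -- need to be computed only up to `≈`.
    data Cone : (Subset n → Carrier) → Set where
      indicatorᶜ : ∀ {f} B → Cover B → (∀ S → f S ≈ ι (χ B S)) → Cone f
      scaleᶜ     : ∀ {f g} c → 0# ≤ c → Cone g → (∀ S → f S ≈ c * g S) → Cone f
      addᶜ       : ∀ {f g h} → Cone g → Cone h → (∀ S → f S ≈ g S + h S) → Cone f

    -- Action of an edge on matching indicators

    crosses : Subset n → Subset n → Bool
    crosses e S = does (∣ S ∩ e ∣ ℕₚ.≟ 1)

    crosses⇒≡1 : ∀ e S → crosses e S ≡ true → ∣ S ∩ e ∣ ≡ 1
    crosses⇒≡1 e S eq = ℕₚ.≡ᵇ⇒≡ _ 1 (≡.subst T (≡.sym eq) _)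

    ≡1⇒crosses : ∀ e S → ∣ S ∩ e ∣ ≡ 1 → crosses e S ≡ true
    ≡1⇒crosses e S = cong (λ m → does (m ℕₚ.≟ 1))

    -- The signless Laplacian of the single edge `e` with weight one, on all levels at once.
    mix : Subset n → (Subset n → Carrier) → Subset n → Carrier
    mix e f S = if crosses e S then f S + f (S △ e) else 0#

    -- A transposition moves `S` only if `S` contains exactly one of the two vertices, and then it
    -- acts as `△ e`.
    exchange : Subset n → (Subset n → Carrier) → Subset n → Carrier
    exchange e f S = if crosses e S then f (S △ e) else f S

    module _ {e : Subset n} {i j : Fin n} (edge : IsEdge e i j) where
      open IsEdge edge

      toggle : ∀ {v} S → lookup e v ≡ true → lookup (S △ e) v ≡ not (lookup S v)
      toggle {v} S v∈e = ≡.trans (lookup-△ S e v) (≡.trans (cong (lookup S v xor_) v∈e) (xor-comm (lookup S v) true))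

      fixed : ∀ {v} S → i ≢ v → j ≢ v → lookup (S △ e) v ≡ lookup S v
      fixed {v} S i≢v j≢v = ≡.trans (lookup-△ S e v)
        (≡.trans (cong (lookup S v xor_) (v∉e v (i≢v ∘ ≡.sym) (j≢v ∘ ≡.sym))) (xor-identityʳ _))

      χ-fixed : ∀ R S → All (i ≢_) (support R) → All (j ≢_) (support R) → χ R (S △ e) ≡ χ R S
      χ-fixed R S i∉R j∉R = χ-local R (λ v∈ → fixed S (All.lookup i∉R v∈) (All.lookup j∉R v∈))

      mix-eval : ∀ B {f} → (∀ S → f S ≈ ι (χ B S)) → ∀ S {r r′} → χ B S ≡ r → χ B (S △ e) ≡ r′ →
                 mix e f S ≈ (if lookup S i xor lookup S j then ι r + ι r′ else 0#)
      mix-eval B f≈ S eq eq′ rewrite meets S with lookup S i xor lookup S j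
      ... | true  = +-cong (trans (f≈ S) (reflexive (cong ι eq))) (trans (f≈ (S △ e)) (reflexive (cong ι eq′)))
      ... | false = refl

      exchange-eval : ∀ B {f} → (∀ S → f S ≈ ι (χ B S)) → ∀ S {r r′} → χ B S ≡ r → χ B (S △ e) ≡ r′ →
                      exchange e f S ≈ ι (if lookup S i xor lookup S j then r′ else r)
      exchange-eval B f≈ S eq eq′ rewrite meets S with lookup S i xor lookup S j
      ... | true  = trans (f≈ (S △ e)) (reflexive (cong ι eq′))
      ... | false = trans (f≈ S) (reflexive (cong ι eq))

      Closed : (Subset n → Carrier) → Set
      Closed f = Cone (mix e f) × Cone (exchange e f)

      0≤2 : 0# ≤ 1# + 1#
      0≤2 = +-nonneg 0≤1 0≤1

      -- The test ignores `i` and `j`, so both summands of `mix` agree, whence the factor two; the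
      -- crossing condition itself becomes the test of a new pair.
      closed-singles : ∀ R {f} → Cover (single i ∷ single j ∷ R) → (∀ S → f S ≈ ι (χ (single i ∷ single j ∷ R) S))
        → Closed f
      closed-singles R {f} cover f≈ with (i≢j ∷ i∉R) ∷ (j∉R ∷ _) ← ↭allFin⇒Unique cover =
        scaleᶜ _ 0≤2 (indicatorᶜ (pair i j ∷ R) cover (λ S → refl)) (λ S → trans
          (mix-eval (single i ∷ single j ∷ R) f≈ S ≡.refl (χ-fixed R S i∉R j∉R))
                (mixᵇ (lookup S i) (lookup S j) (χ R S))) ,
        indicatorᶜ (single i ∷ single j ∷ R) cover (λ S → trans (exchange-eval (single i ∷ single j ∷ R) f≈ S ≡.refl (χ-fixed R S i∉R j∉R))
          (exchangeᵇ (lookup S i xor lookup S j) (χ R S)))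
        where
        mixᵇ : ∀ s t r → (if s xor t then ι r + ι r else 0#) ≈ (1# + 1#) * ι ((s xor t) ∧ r)
        mixᵇ s t r with s xor t
        ... | true  = x+x≈2x (ι r)
        ... | false = sym (zeroʳ _)
        exchangeᵇ : ∀ b r → ι (if b then r else r) ≈ ι r
        exchangeᵇ true  r = refl
        exchangeᵇ false r = refl

      -- A closed loop of a Brauer diagram, with value two: toggling both ends of a pair does not
      -- change whether they are separated.
      closed-pair : ∀ R {f} → Cover (pair i j ∷ R) → (∀ S → f S ≈ ι (χ (pair i j ∷ R) S)) → Closed f
      closed-pair R {f} cover f≈ =
        scaleᶜ _ 0≤2 (indicatorᶜ (pair i j ∷ R) cover (λ S → refl)) (λ S → trans
          (mix-eval (pair i j ∷ R) f≈ S ≡.refl (toggled S)) (mixᵇ (lookup S i) (lookup S j) (χ R S))) ,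
        indicatorᶜ (pair i j ∷ R) cover (λ S → trans (exchange-eval (pair i j ∷ R) f≈ S ≡.refl (toggled S))
          (exchangeᵇ (lookup S i) (lookup S j) (χ R S)))
        where
        toggled : ∀ S → χ (pair i j ∷ R) (S △ e) ≡ (not (lookup S i) xor not (lookup S j)) ∧ χ R S
        toggled S with (i≢j ∷ i∉R) ∷ (j∉R ∷ _) ← ↭allFin⇒Unique cover =
          cong₂ _∧_ (cong₂ _xor_ (toggle S i∈e) (toggle S j∈e)) (χ-fixed R S i∉R j∉R)
        mixᵇ : ∀ s t r → (if s xor t then ι ((s xor t) ∧ r) + ι ((not s xor not t) ∧ r) else 0#)
          ≈ (1# + 1#) * ι ((s xor t) ∧ r)
        mixᵇ true  true  r = sym (zeroʳ _)
        mixᵇ true  false r = x+x≈2x (ι r)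
        mixᵇ false true  r = x+x≈2x (ι r)
        mixᵇ false false r = sym (zeroʳ _)
        exchangeᵇ : ∀ s t r → ι (if s xor t then (not s xor not t) ∧ r else (s xor t) ∧ r) ≈ ι ((s xor t) ∧ r)
        exchangeᵇ true  true  r = refl
        exchangeᵇ true  false r = refl
        exchangeᵇ false true  r = refl
        exchangeᵇ false false r = refl

      -- When `S` crosses `e`, exactly one of `S` and `S △ e` separates `i` from `a`. The two
      -- summands of `mix` thus lose all dependence on `a`, which becomes unmatched.
      closed-pair-single : ∀ a R {f} → Cover (pair i a ∷ single j ∷ R) → (∀ S → f S ≈ ι (χ (pair i a ∷ single j ∷ R) S))
        → Closed f
      closed-pair-single a R {f} cover f≈ =
        indicatorᶜ (pair i j ∷ single a ∷ R) (↭-trans (prep i (swap j a ↭-refl)) cover) (λ S → trans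
          (mix-eval (pair i a ∷ single j ∷ R) f≈ S ≡.refl (toggled S))
                (mixᵇ (lookup S i) (lookup S j) (lookup S a) (χ R S))) ,
        indicatorᶜ (pair j a ∷ single i ∷ R) (↭-trans (prep j (swap a i ↭-refl)) (↭-trans (swap j i ↭-refl) (↭-trans (prep i (swap j a ↭-refl)) cover)))
          (λ S → trans (exchange-eval (pair i a ∷ single j ∷ R) f≈ S ≡.refl (toggled S))
                (exchangeᵇ (lookup S i) (lookup S j) (lookup S a) (χ R S)))
        where
        toggled : ∀ S → χ (pair i a ∷ single j ∷ R) (S △ e) ≡ (not (lookup S i) xor lookup S a) ∧ χ R S
        toggled S with (i≢a ∷ i≢j ∷ i∉R) ∷ (a≢j ∷ _) ∷ (j∉R ∷ _) ← ↭allFin⇒Unique cover =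
          cong₂ _∧_ (cong₂ _xor_ (toggle S i∈e) (fixed S i≢a (a≢j ∘ ≡.sym))) (χ-fixed R S i∉R j∉R)
        mixᵇ : ∀ s t x r → (if s xor t then ι ((s xor x) ∧ r) + ι ((not s xor x) ∧ r) else 0#) ≈ ι ((s xor t) ∧ r)
        mixᵇ true  true  x     r = refl
        mixᵇ false false x     r = refl
        mixᵇ true  false true  r = +-identityˡ _
        mixᵇ true  false false r = +-identityʳ _
        mixᵇ false true  true  r = +-identityʳ _
        mixᵇ false true  false r = +-identityˡ _
        exchangeᵇ : ∀ s t x r → ι (if s xor t then (not s xor x) ∧ r else (s xor x) ∧ r) ≈ ι ((t xor x) ∧ r)
        exchangeᵇ true  true  x r = refl
        exchangeᵇ true  false x r = refl
        exchangeᵇ false true  x r = refl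
        exchangeᵇ false false x r = refl

      -- When `S` crosses `e`, both pair tests can hold only if `a` and `b` are separated too, and
      -- in that case exactly one of `S` and `S △ e` passes them.
      closed-pairs : ∀ a b R {f} → Cover (pair i a ∷ pair j b ∷ R) → (∀ S → f S ≈ ι (χ (pair i a ∷ pair j b ∷ R) S))
        → Closed f
      closed-pairs a b R {f} cover f≈ =
        indicatorᶜ (pair i j ∷ pair a b ∷ R) (↭-trans (prep i (swap j a ↭-refl)) cover) (λ S → trans
          (mix-eval (pair i a ∷ pair j b ∷ R) f≈ S ≡.refl (toggled S))
                (mixᵇ (lookup S i) (lookup S j) (lookup S a) (lookup S b) (χ R S))) ,
        indicatorᶜ (pair j a ∷ pair i b ∷ R) (↭-trans (prep j (swap a i ↭-refl)) (↭-trans (swap j i ↭-refl) (↭-trans (prep i (swap j a ↭-refl)) cover)))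
          (λ S → trans (exchange-eval (pair i a ∷ pair j b ∷ R) f≈ S ≡.refl (toggled S))
                (exchangeᵇ (lookup S i) (lookup S j) (lookup S a) (lookup S b) (χ R S)))
        where
        toggled : ∀ S → χ (pair i a ∷ pair j b ∷ R) (S △ e) ≡
                  (not (lookup S i) xor lookup S a) ∧ (not (lookup S j) xor lookup S b) ∧ χ R S
        toggled S with (i≢a ∷ i≢j ∷ i≢b ∷ i∉R) ∷ (a≢j ∷ _) ∷ (j≢b ∷ j∉R) ∷ _ ← ↭allFin⇒Unique cover =
          cong₂ _∧_ (cong₂ _xor_ (toggle S i∈e) (fixed S i≢a (a≢j ∘ ≡.sym)))
            (cong₂ _∧_ (cong₂ _xor_ (toggle S j∈e) (fixed S i≢b j≢b)) (χ-fixed R S i∉R j∉R))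
        mixᵇ : ∀ s t x y r →
          (if s xor t then ι ((s xor x) ∧ (t xor y) ∧ r) + ι ((not s xor x) ∧ (not t xor y) ∧ r) else 0#)
          ≈ ι ((s xor t) ∧ (x xor y) ∧ r)
        mixᵇ true  true  x     y     r = refl
        mixᵇ false false x     y     r = refl
        mixᵇ true  false true  true  r = +-identityˡ _
        mixᵇ true  false true  false r = +-identityˡ _
        mixᵇ true  false false true  r = +-identityʳ _
        mixᵇ true  false false false r = +-identityˡ _
        mixᵇ false true  true  true  r = +-identityˡ _
        mixᵇ false true  true  false r = +-identityʳ _
        mixᵇ false true  false true  r = +-identityˡ _
        mixᵇ false true  false false r = +-identityˡ _
        exchangeᵇ : ∀ s t x y r →
          ι (if s xor t then (not s xor x) ∧ (not t xor y) ∧ r else (s xor x) ∧ (t xor y) ∧ r)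
          ≈ ι ((t xor x) ∧ (s xor y) ∧ r)
        exchangeᵇ true  true  x y r = refl
        exchangeᵇ true  false x y r = refl
        exchangeᵇ false true  x y r = refl
        exchangeᵇ false false x y r = refl

    closed-indicator : ∀ {e i j} (edge : IsEdge e i j) B {f} → Cover B → (∀ S → f S ≈ ι (χ B S)) → Closed edge f
    closed-indicator {e} {i} {j} edge B {f} cover f≈ = locate-i (extract B (∈-resp-↭ (↭-sym cover) (∈-allFin i)))
      where
      open IsEdge edge
      Cover-~ : ∀ {C} → B ~ C → Cover C
      Cover-~ (p , _) = ↭-trans (↭-sym p) cover
      f≈-~ : ∀ {C} → B ~ C → ∀ S → f S ≈ ι (χ C S)
      f≈-~ (_ , eq) S = trans (f≈ S) (reflexive (cong ι (eq S)))
      j∈ : ∀ {C} → B ~ C → j ∈ support C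
      j∈ eq = ∈-resp-↭ (↭-sym (Cover-~ eq)) (∈-allFin j)
      locate-i : Extraction B i → Closed edge f
      locate-i (R , inj₁ eq) with j∈ eq
      ... | here j≡i = contradiction (≡.sym j≡i) i≢j
      ... | there j∈R with extract R j∈R
      ... | R′ , inj₁ eq′ = closed-singles edge R′ (Cover-~ eq″) (f≈-~ eq″)
        where eq″ = ~-trans eq (~-cons (single i) eq′)
      -- `Closed` depends on the edge only through `e`, so the mirrored case is the same lemma with
      -- the endpoints exchanged.
      ... | R′ , inj₂ (a , eq′) = closed-pair-single (IsEdge-sym edge) a R′ (Cover-~ eq″) (f≈-~ eq″)
        where eq″ = ~-trans eq (~-trans (~-cons (single i) eq′) (~-swap (single i) (pair j a) R′))
      locate-i (R , inj₂ (a , eq)) with j∈ eq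
      ... | here j≡i = contradiction (≡.sym j≡i) i≢j
      ... | there (here ≡.refl) = closed-pair edge R (Cover-~ eq) (f≈-~ eq)
      ... | there (there j∈R) with extract R j∈R
      ... | R′ , inj₁ eq′ = closed-pair-single edge a R′ (Cover-~ eq″) (f≈-~ eq″)
        where eq″ = ~-trans eq (~-cons (pair i a) eq′)
      ... | R′ , inj₂ (b , eq′) = closed-pairs edge a b R′ (Cover-~ eq″) (f≈-~ eq″)
        where eq″ = ~-trans eq (~-cons (pair i a) eq′)

    module _ {e : Subset n} (∣e∣≡2 : ∣ e ∣ ≡ 2) where

      private
        edge = proj₂ (proj₂ (∣e∣≡2⇒edge e ∣e∣≡2))

      mix-cone : ∀ {f} → Cone f → Cone (mix e f)
      mix-cone (indicatorᶜ B cover f≈) = proj₁ (closed-indicator edge B cover f≈)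
      mix-cone {f} (scaleᶜ {g = g} c 0≤c g∈ f≈) = scaleᶜ c 0≤c (mix-cone g∈) eq
        where
        eq : ∀ S → mix e f S ≈ c * mix e g S
        eq S with crosses e S
        ... | true  = trans (+-cong (f≈ S) (f≈ (S △ e))) (sym (distribˡ c _ _))
        ... | false = sym (zeroʳ c)
      mix-cone {f} (addᶜ {g = g} {h} g∈ h∈ f≈) = addᶜ (mix-cone g∈) (mix-cone h∈) eq
        where
        eq : ∀ S → mix e f S ≈ mix e g S + mix e h S
        eq S with crosses e S
        ... | true  = trans (+-cong (f≈ S) (f≈ (S △ e)))
          (solve 4 (λ a b c d → a :+ b :+ (c :+ d) := a :+ c :+ (b :+ d)) refl _ _ _ _)
        ... | false = sym (+-identityˡ 0#)

      exchange-cone : ∀ {f} → Cone f → Cone (exchange e f)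
      exchange-cone (indicatorᶜ B cover f≈) = proj₂ (closed-indicator edge B cover f≈)
      exchange-cone {f} (scaleᶜ {g = g} c 0≤c g∈ f≈) = scaleᶜ c 0≤c (exchange-cone g∈) eq
        where
        eq : ∀ S → exchange e f S ≈ c * exchange e g S
        eq S with crosses e S
        ... | true  = f≈ (S △ e)
        ... | false = f≈ S
      exchange-cone {f} (addᶜ {g = g} {h} g∈ h∈ f≈) = addᶜ (exchange-cone g∈) (exchange-cone h∈) eq
        where
        eq : ∀ S → exchange e f S ≈ exchange e g S + exchange e h S
        eq S with crosses e S
        ... | true  = f≈ (S △ e)
        ... | false = f≈ S

  -- Counting the subsets of each size that pass a test

  module _ {n : ℕ} where

    -- Sum over the ways of inserting k of the listed vertices into S and removing the others.
    ∑-sub : List (Fin n) → ℕ → (Subset n → Carrier) → Subset n → Carrier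
    ∑-sub []       zero    f S = f S
    ∑-sub []       (suc k) f S = 0#
    ∑-sub (v ∷ vs) zero    f S = ∑-sub vs zero f (S [ v ]≔ false)
    ∑-sub (v ∷ vs) (suc k) f S = ∑-sub vs (suc k) f (S [ v ]≔ false) + ∑-sub vs k f (S [ v ]≔ true)

    ∑-sub-∷ : ∀ v {vs ws f} → (∀ k S → ∑-sub vs k f S ≈ ∑-sub ws k f S) →
              ∀ k S → ∑-sub (v ∷ vs) k f S ≈ ∑-sub (v ∷ ws) k f S
    ∑-sub-∷ v eq zero    S = eq zero _
    ∑-sub-∷ v eq (suc k) S = +-cong (eq (suc k) _) (eq k _)

    -- Allows the vertices to be inserted in the order of the blocks instead of their natural order.
    ∑-sub-↭ : ∀ {vs ws} → vs ↭ ws → ∀ k f S → ∑-sub vs k f S ≈ ∑-sub ws k f S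
    ∑-sub-↭ _↭_.refl k f S = refl
    ∑-sub-↭ (prep x p) k f S = ∑-sub-∷ x (λ k → ∑-sub-↭ p k f) k S
    ∑-sub-↭ (_↭_.trans p q) k f S = trans (∑-sub-↭ p k f S) (∑-sub-↭ q k f S)
    ∑-sub-↭ (swap {xs} {ys} x y p) k f S with x ≟ᶠ y
    -- The lists may contain repetitions. Updates at one vertex with different values do not
    -- commute, but the two heads then coincide.
    ... | yes ≡.refl = ∑-sub-∷ x (∑-sub-∷ x (λ k → ∑-sub-↭ p k f)) k S
    ... | no  x≢y = swapped k
      where
      step : ∀ k a b → ∑-sub xs k f (S [ x ]≔ a [ y ]≔ b) ≈ ∑-sub ys k f (S [ y ]≔ b [ x ]≔ a)
      step k a b = trans (∑-sub-↭ p k f _) (reflexive (cong (∑-sub ys k f) ([]≔-commutes S x y x≢y)))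
      swapped : ∀ k → ∑-sub (x ∷ y ∷ xs) k f S ≈ ∑-sub (y ∷ x ∷ ys) k f S
      swapped zero = step zero false false
      swapped (suc zero) = trans (+-cong (+-cong (step _ _ _) (step _ _ _)) (step _ _ _))
        (solve 3 (λ a b c → a :+ b :+ c := a :+ c :+ b) refl _ _ _)
      swapped (suc (suc k)) = trans (+-cong (+-cong (step _ _ _) (step _ _ _)) (+-cong (step _ _ _) (step _ _ _)))
        (solve 4 (λ a b c d → a :+ b :+ (c :+ d) := a :+ c :+ (b :+ d)) refl _ _ _ _)

    -- Every subset reached agrees with `S` away from `vs`, so a condition on vertices already
    -- decided may be treated as a constant.
    ∑-sub-cong : ∀ vs k {f g} S →
      (∀ T → (∀ v → All (v ≢_) vs → lookup T v ≡ lookup S v) → f T ≈ g T) →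
      ∑-sub vs k f S ≈ ∑-sub vs k g S
    ∑-sub-cong []       zero    S f≈g = f≈g S (λ v _ → ≡.refl)
    ∑-sub-cong []       (suc k) S f≈g = refl
    ∑-sub-cong (w ∷ vs) k {f} {g} S f≈g = split k
      where
      restrict : ∀ b T → (∀ v → All (v ≢_) vs → lookup T v ≡ lookup (S [ w ]≔ b) v) → f T ≈ g T
      restrict b T T≡S = f≈g T λ { v (v≢w ∷ v∉vs) → ≡.trans (T≡S v v∉vs) (lookup∘update′ v≢w S b) }
      split : ∀ k → ∑-sub (w ∷ vs) k f S ≈ ∑-sub (w ∷ vs) k g S
      split zero    = ∑-sub-cong vs zero _ (restrict false)
      split (suc k) = +-cong (∑-sub-cong vs (suc k) _ (restrict false)) (∑-sub-cong vs k _ (restrict true))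

    ∑-sub-zero : ∀ vs k S → ∑-sub vs k (λ _ → 0#) S ≈ 0#
    ∑-sub-zero []       zero    S = refl
    ∑-sub-zero []       (suc k) S = refl
    ∑-sub-zero (v ∷ vs) zero    S = ∑-sub-zero vs zero _
    ∑-sub-zero (v ∷ vs) (suc k) S = trans (+-cong (∑-sub-zero vs (suc k) _) (∑-sub-zero vs k _)) (+-identityˡ 0#)

    -- The coefficient of tᵏ in (2t)ᵖ (1 + t)ᑫ, where B consists of p pairs and q singles.
    coefficient : List (Block n) → ℕ → Carrier
    coefficient []             zero    = 1#
    coefficient []             (suc k) = 0#
    coefficient (single _ ∷ B) zero    = coefficient B zero
    coefficient (single _ ∷ B) (suc k) = coefficient B (suc k) + coefficient B k
    coefficient (pair _ _ ∷ B) zero    = 0#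
    coefficient (pair _ _ ∷ B) (suc k) = coefficient B k + coefficient B k

    -- The result is independent of `S` because the insertions decide every vertex that the test
    -- inspects. A single contributes the factor 1 + t; of the four choices for a pair, only the two
    -- that separate it survive, giving 2t.
    ∑-sub-χ : ∀ B → Unique (support B) → ∀ k S → ∑-sub (support B) k (ι ∘ χ B) S ≈ coefficient B k
    ∑-sub-χ []             _ zero    S = refl
    ∑-sub-χ []             _ (suc k) S = refl
    ∑-sub-χ (single a ∷ B) (_ ∷ B!) zero    S = ∑-sub-χ B B! zero _
    ∑-sub-χ (single a ∷ B) (_ ∷ B!) (suc k) S = +-cong (∑-sub-χ B B! (suc k) _) (∑-sub-χ B B! k _)
    ∑-sub-χ (pair a b ∷ B) ((a≢b ∷ a∉B) ∷ b∉B ∷ B!) k S = sum k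
      where
      term : ∀ k x y → ∑-sub (support B) k (ι ∘ χ (pair a b ∷ B)) (S [ a ]≔ x [ b ]≔ y)
        ≈ (if x xor y then coefficient B k else 0#)
      term k x y = trans (∑-sub-cong (support B) k T₀ λ T T≡ → reflexive (cong (λ c → ι (c ∧ χ B T))
          (cong₂ _xor_ (≡.trans (T≡ a a∉B) (≡.trans (lookup∘update′ a≢b (S [ a ]≔ x) y) (lookup∘update a S x)))
                       (≡.trans (T≡ b b∉B) (lookup∘update b (S [ a ]≔ x) y)))))
        (constant (x xor y))
        where
        T₀ = S [ a ]≔ x [ b ]≔ y
        constant : ∀ c → ∑-sub (support B) k (λ T → ι (c ∧ χ B T)) T₀ ≈ (if c then coefficient B k else 0#)
        constant true  = ∑-sub-χ B B! k T₀
        constant false = ∑-sub-zero (support B) k T₀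
      sum : ∀ k → ∑-sub (a ∷ b ∷ support B) k (ι ∘ χ (pair a b ∷ B)) S ≈ coefficient (pair a b ∷ B) k
      sum zero = term zero false false
      sum (suc zero) = trans (+-cong (+-cong (term 1 false false) (term 0 false true)) (term 0 true false))
        (+-congʳ (+-identityˡ _))
      sum (suc (suc k)) = trans (+-cong (+-cong (term (suc (suc k)) false false) (term (suc k) false true))
                                          (+-cong (term (suc k) true false) (term k true true)))
        (+-cong (+-identityˡ _) (+-identityʳ _))

    coefficient-nonneg : ∀ B k → 0# ≤ coefficient B k
    coefficient-nonneg []             zero    = 0≤1
    coefficient-nonneg []             (suc k) = ≤-refl
    coefficient-nonneg (single _ ∷ B) zero    = coefficient-nonneg B zero
    coefficient-nonneg (single _ ∷ B) (suc k) = +-nonneg (coefficient-nonneg B (suc k)) (coefficient-nonneg B k)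
    coefficient-nonneg (pair _ _ ∷ B) zero    = ≤-refl
    coefficient-nonneg (pair _ _ ∷ B) (suc k) = +-nonneg (coefficient-nonneg B k) (coefficient-nonneg B k)

    -- Symmetric unimodality, in a form stable under multiplication by 1 + t and by 2t.
    coefficient-mono : ∀ B {i j} → i ℕ.≤ j → i ℕ.+ j ℕ.≤ length (support B) → coefficient B i ≤ coefficient B j
    coefficient-mono [] {zero} {zero} _ _ = ≤-refl
    coefficient-mono (single _ ∷ B) {zero} {zero} _ _ = ≤-refl
    coefficient-mono (single _ ∷ B) {zero} {suc j} _ (s≤s j≤n) =
      ≤-trans (coefficient-mono B z≤n j≤n) (≤-by _ (coefficient-nonneg B (suc j)) (+-comm _ _))
    -- The terms are compared crosswise, `i` with `suc j` and `suc i` with `j`: comparing `suc i`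
    -- with `suc j` would exceed the permitted index sum by one. The second comparison needs `i`
    -- below `j`, so equality is treated apart.
    coefficient-mono (single _ ∷ B) {suc i} {suc j} (s≤s i≤j) (s≤s i+1+j≤n) with i ℕₚ.≟ j
    ... | yes ≡.refl = ≤-refl
    ... | no  i≢j = ≤-respˡ-≈ (+-comm _ _) (+-mono-≤
      (coefficient-mono B (ℕₚ.m≤n⇒m≤1+n i≤j) i+1+j≤n)
      (coefficient-mono B (ℕₚ.≤∧≢⇒< i≤j i≢j) (ℕₚ.≤-trans (ℕₚ.≤-reflexive (≡.sym (ℕₚ.+-suc i j))) i+1+j≤n)))
    coefficient-mono (pair _ _ ∷ B) {zero}  {j}     _ _ = coefficient-nonneg (pair _ _ ∷ B) j
    coefficient-mono (pair a b ∷ B) {suc i} {suc j} (s≤s i≤j) (s≤s i+1+j≤n+1) = +-mono-≤ mono mono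
      where
      mono = coefficient-mono B i≤j (ℕₚ.≤-pred (ℕₚ.≤-trans (ℕₚ.≤-reflexive (≡.sym (ℕₚ.+-suc i j))) i+1+j≤n+1))

  ∑-sub-map-suc : ∀ {n} vs k (f : Subset (suc n) → Carrier) b S →
                  ∑-sub (map suc vs) k f (b ∷ S) ≡ ∑-sub vs k (f ∘ (b ∷_)) S
  ∑-sub-map-suc []       zero    f b S = ≡.refl
  ∑-sub-map-suc []       (suc k) f b S = ≡.refl
  ∑-sub-map-suc (v ∷ vs) zero    f b S = ∑-sub-map-suc vs zero f b _
  ∑-sub-map-suc (v ∷ vs) (suc k) f b S = cong₂ _+_ (∑-sub-map-suc vs (suc k) f b _) (∑-sub-map-suc vs k f b _)

  mass : ∀ {n} → ℕ → (Subset n → Carrier) → Carrier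
  mass {n} k f = ∑ (kSubsets n k) (f ∘ proj₁)

  -- Any starting subset will do, since each vertex is overwritten once. The recursion of `kSubsets`
  -- on the first vertex is the first insertion.
  mass≈∑-sub : ∀ {n} k (f : Subset n → Carrier) S → mass k f ≈ ∑-sub (allFin n) k f S
  mass≈∑-sub {zero}  zero    f [] = +-identityʳ _
  mass≈∑-sub {zero}  (suc k) f S  = refl
  mass≈∑-sub {suc n} k       f (b ∷ S) = trans (split k)
    (reflexive (cong (λ vs → ∑-sub (zero ∷ vs) k f (b ∷ S)) (map-tabulate (λ i → i) suc)))
    where
    half : ∀ b k → mass k (f ∘ (b ∷_)) ≈ ∑-sub (map suc (allFin n)) k f (b ∷ S)
    half b k = trans (mass≈∑-sub k (f ∘ (b ∷_)) S) (reflexive (≡.sym (∑-sub-map-suc (allFin n) k f b S)))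
    split : ∀ k → mass k f ≈ ∑-sub (zero ∷ map suc (allFin n)) k f (b ∷ S)
    split zero    = trans (reflexive (∑-map outsideᵏ (kSubsets n zero) (f ∘ proj₁))) (half false zero)
    split (suc k) = trans (∑-++ (map insideᵏ (kSubsets n k)) _ _) (trans (+-comm _ _) (+-cong
      (trans (reflexive (∑-map outsideᵏ (kSubsets n (suc k)) (f ∘ proj₁))) (half false (suc k)))
      (trans (reflexive (∑-map insideᵏ (kSubsets n k) (f ∘ proj₁))) (half true k))))

  mass-mono : ∀ {n} {f : Subset n → Carrier} → Cone f → ∀ {i j} → i ℕ.≤ j → i ℕ.+ j ℕ.≤ n → mass i f ≤ mass j f
  mass-mono {n} {f} (indicatorᶜ B cover f≈) {i} {j} i≤j i+j≤n =
    ≤-respˡ-≈ (sym (eval i)) (≤-respʳ-≈ (sym (eval j)) (coefficient-mono B i≤j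
      (ℕₚ.≤-trans i+j≤n (ℕₚ.≤-reflexive (≡.sym (≡.trans (↭-length cover) (length-tabulate (λ i → i))))))))
    where
    eval : ∀ k → mass k f ≈ coefficient B k
    eval k = trans (∑-cong (kSubsets n k) (λ S → f≈ (proj₁ S))) (trans (mass≈∑-sub k (ι ∘ χ B) (replicate n false))
      (trans (∑-sub-↭ (↭-sym cover) k _ _) (∑-sub-χ B (↭allFin⇒Unique cover) k _)))
  mass-mono {n} {f} (scaleᶜ {g = g} c 0≤c g∈ f≈) {i} {j} i≤j i+j≤n =
    ≤-respˡ-≈ (sym (eval i)) (≤-respʳ-≈ (sym (eval j)) (*-monoˡ-≤ c 0≤c (mass-mono g∈ i≤j i+j≤n)))
    where
    eval : ∀ k → mass k f ≈ c * mass k g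
    eval k = trans (∑-cong (kSubsets n k) (λ S → f≈ (proj₁ S))) (∑-*ˡ (kSubsets n k) c _)
  mass-mono {n} {f} (addᶜ {g = g} {h} g∈ h∈ f≈) {i} {j} i≤j i+j≤n =
    ≤-respˡ-≈ (sym (eval i)) (≤-respʳ-≈ (sym (eval j)) (+-mono-≤ (mass-mono g∈ i≤j i+j≤n) (mass-mono h∈ i≤j i+j≤n)))
    where
    eval : ∀ k → mass k f ≈ mass k g + mass k h
    eval k = trans (∑-cong (kSubsets n k) (λ S → f≈ (proj₁ S))) (∑-+ (kSubsets n k) _ _)

  -- From operators preserving the cone to eigenvalue inequalities

  module _ {n : ℕ} where

    -- The indicator of the empty matching, whose test is vacuous.
    𝟙-cone : Cone {n} (λ _ → 1#)
    𝟙-cone = indicatorᶜ (map single (allFin n)) (↭-reflexive (support-singles (allFin n)))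
               (λ S → reflexive (cong ι (≡.sym (χ-singles (allFin n) S))))
      where
      support-singles : ∀ vs → support (map single vs) ≡ vs
      support-singles []       = ≡.refl
      support-singles (v ∷ vs) = cong (v ∷_) (support-singles vs)
      χ-singles : ∀ vs S → χ (map single vs) S ≡ true
      χ-singles []       S = ≡.refl
      χ-singles (v ∷ vs) S = χ-singles vs S

    cone-∑ : ∀ {A : Set} (xs : List A) {f : A → Subset n → Carrier} → (∀ x → Cone (f x)) →
             Cone (λ S → ∑ xs (λ x → f x S))
    cone-∑ []       f∈ = scaleᶜ 0# ≤-refl 𝟙-cone (λ S → sym (zeroˡ _))
    cone-∑ (x ∷ xs) f∈ = addᶜ (f∈ x) (cone-∑ xs f∈) (λ S → refl)

    module _ (H : (Subset n → Carrier) → Subset n → Carrier) (M : ∀ k → Matrixᴵ {KSubset n k})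
             (M-sym : ∀ k → Symmetric (M k)) (M≥0 : ∀ k → Nonnegative (M k))
             (M-action : ∀ k f S → mul (kSubsets n k) (M k) (f ∘ proj₁) S ≈ H f (proj₁ S))
             (H-cone : ∀ {f} → Cone f → Cone (H f)) where

      power-action : ∀ k {x f} → (∀ S → x S ≈ f (proj₁ S)) → ∀ m S →
                     power (kSubsets n k) (M k) x m S ≈ fold f H m (proj₁ S)
      power-action k x≈f zero    S = x≈f S
      power-action k {f = f} x≈f (suc m) S = trans
        (mul-cong (kSubsets n k) (M k) (λ {T} _ → power-action k x≈f m T) S) (M-action k (fold f H m) S)

      iterate-cone : ∀ {f} → Cone f → ∀ m → Cone (fold f H m)
      iterate-cone f∈ zero    = f∈
      iterate-cone f∈ (suc m) = H-cone (iterate-cone f∈ m)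

      compare : ∀ k → 2 ℕ.* k ℕ.< n → ∀ {μ v ν} → Eigenvector (kSubsets n k) (M k) μ v →
                (∀ s u → Eigenvector (kSubsets n (suc k)) (M (suc k)) s u → s ≤ ν) → μ ≤ ν
      compare k 2k<n eigen eigenvalue≤ν = eigenvalue≤ (kSubsets n k) (kSubsets n (suc k)) (kSubsets-complete n k)
        (M≥0 k) (M-sym (suc k)) (M≥0 (suc k)) mass≤ eigen
        (quad≤ν _≟ᵏ_ (kSubsets-unique n (suc k)) (kSubsets-complete n (suc k)) (M-sym (suc k)) eigenvalue≤ν)
        where
        f : ℕ → Subset n → Carrier
        f m = fold (fold (λ _ → 1#) H m) H m
        mass-power : ∀ k m → mass k (f m)
          ≈ ∑ (kSubsets n k) (power (kSubsets n k) (M k) (power (kSubsets n k) (M k) 𝟙 m) m)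
        mass-power k m = ∑-cong (kSubsets n k) (λ S → sym (power-action k (power-action k (λ _ → refl) m) m S))
        -- The only use of k < n/2: in the form k + (k + 1) ≤ n it is the bound on the index sum
        -- under which the coefficients increase.
        k+1+k≤n : k ℕ.+ suc k ℕ.≤ n
        k+1+k≤n = ℕₚ.≤-trans (ℕₚ.≤-reflexive (≡.trans (ℕₚ.+-suc k k) (cong (λ m → suc (k ℕ.+ m)) (≡.sym (ℕₚ.+-identityʳ k))))) 2k<n
        mass≤ : ∀ m → _ ≤ _
        mass≤ m = ≤-respˡ-≈ (mass-power k m) (≤-respʳ-≈ (mass-power (suc k) m)
          (mass-mono (iterate-cone (iterate-cone 𝟙-cone m) m) (ℕₚ.n≤1+n k) k+1+k≤n))

  -- Token matrices as sums over edges

  module _ {n : ℕ} (G : WeightedGraph ℝ n) where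
    open WeightedGraph G

    pairs : List (KSubset n 2)
    pairs = kSubsets n 2

    w₀-nonneg : ∀ e → 0# ≤ w₀ e
    w₀-nonneg e with T? (E e)
    ... | yes e∈E = w-nonneg (e , e∈E)
    ... | no  _   = ≤-refl

    adjacency-nonneg : ∀ k → Nonnegative (tokenAdjacency ℝ G k)
    adjacency-nonneg k (S , _) (T , _) with ∣ S △ T ∣ ℕₚ.≟ 2
    ... | yes p = w₀-nonneg (S △ T , p)
    ... | no  _ = ≤-refl

    adjacency-sym : ∀ k → Symmetric (tokenAdjacency ℝ G k)
    adjacency-sym k (S , _) (T , _) with ∣ S △ T ∣ ℕₚ.≟ 2 | ∣ T △ S ∣ ℕₚ.≟ 2
    ... | yes p | yes q = reflexive (cong w₀ (KSubset-≡ (△-comm S T)))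
    ... | no  _ | no  _ = refl
    ... | yes p | no ¬q = contradiction (≡.trans (cong ∣_∣ (△-comm T S)) p) ¬q
    ... | no ¬p | yes q = contradiction (≡.trans (cong ∣_∣ (△-comm S T)) q) ¬p

    degree-nonneg : ∀ k S → 0# ≤ tokenDegree ℝ G k S
    degree-nonneg k (S , _) = ∑-nonneg pairs term-nonneg
      where
      term-nonneg : ∀ e → 0# ≤ (if crosses (proj₁ e) S then w₀ e else 0#)
      term-nonneg e with crosses (proj₁ e) S
      ... | true  = w₀-nonneg e
      ... | false = ≤-refl

    signless-nonneg : ∀ k → Nonnegative (tokenSignlessLaplacian ℝ G k)
    signless-nonneg k S T = +-nonneg diagonal (adjacency-nonneg k S T)
      where
      diagonal : 0# ≤ tokenDegreeMatrix ℝ G k S T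
      diagonal with proj₁ S ≟ˢ proj₁ T
      ... | yes _ = degree-nonneg k S
      ... | no  _ = ≤-refl

    signless-sym : ∀ k → Symmetric (tokenSignlessLaplacian ℝ G k)
    signless-sym k S T = +-cong diagonal (adjacency-sym k S T)
      where
      diagonal : tokenDegreeMatrix ℝ G k S T ≈ tokenDegreeMatrix ℝ G k T S
      diagonal with proj₁ S ≟ˢ proj₁ T | proj₁ T ≟ˢ proj₁ S
      ... | yes p | yes _ = reflexive (cong (tokenDegree ℝ G k) (KSubset-≡ {S = S} {T} p))
      ... | no  _ | no  _ = refl
      ... | yes p | no ¬q = contradiction (≡.sym p) ¬q
      ... | no ¬p | yes q = contradiction (≡.sym q) ¬p

    hop : (Subset n → Carrier) → Subset n → KSubset n 2 → Carrier
    hop f S e = if crosses (proj₁ e) S then w₀ e * f (S △ proj₁ e) else 0#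

    -- A double count: `cell` is supported where `S △ T` equals `e`. For fixed `T` this singles out
    -- one edge, and for fixed `e` one neighbour, present exactly when `S` crosses `e`.
    adjacency-action : ∀ k f S → mul (kSubsets n k) (tokenAdjacency ℝ G k) (f ∘ proj₁) S ≈ ∑ pairs (hop f (proj₁ S))
    adjacency-action k f (S , ∣S∣≡k) = trans (∑-cong (kSubsets n k) row)
      (trans (∑-swap (kSubsets n k) pairs cell) (∑-cong pairs column))
      where
      cell : KSubset n k → KSubset n 2 → Carrier
      cell (T , _) (e , p) = if does ((S △ T) ≟ˢ e) then w₀ (e , p) * f T else 0#
      row : ∀ T → tokenAdjacency ℝ G k (S , ∣S∣≡k) T * f (proj₁ T) ≈ ∑ pairs (cell T)
      row (T , q) with ∣ S △ T ∣ ℕₚ.≟ 2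
      ... | yes p = sym (trans (∑-single pairs (kSubsets-unique n 2) (kSubsets-complete n 2 (S △ T , p)) (cell (T , q)) off) on)
        where
        off : ∀ e → (S △ T , p) ≢ e → cell (T , q) e ≈ 0#
        off (e , _) ≢e with (S △ T) ≟ˢ e
        ... | yes eq = contradiction (KSubset-≡ eq) ≢e
        ... | no  _  = refl
        on : cell (T , q) (S △ T , p) ≈ w₀ (S △ T , p) * f T
        on with (S △ T) ≟ˢ (S △ T)
        ... | yes _ = refl
        ... | no ¬q = contradiction ≡.refl ¬q
      ... | no ¬p = trans (zeroˡ _) (sym (∑-zero pairs (λ {e} _ → off e)))
        where
        off : ∀ e → cell (T , q) e ≈ 0#
        off (e , r) with (S △ T) ≟ˢ e
        ... | yes ≡.refl = contradiction r ¬p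
        ... | no  _      = refl
      column : ∀ e → ∑ (kSubsets n k) (λ T → cell T e) ≈ hop f S e
      column (e , ∣e∣≡2) with crosses e S in eq
      ... | true = trans (∑-single (kSubsets n k) (kSubsets-unique n k) (kSubsets-complete n k T₀) (λ T → cell T (e , ∣e∣≡2)) off) on
        where
        T₀ : KSubset n k
        T₀ = S △ e , ≡.trans (∣S∩e∣⇒∣S△e∣ {S = S} ∣e∣≡2 (crosses⇒≡1 e S eq)) ∣S∣≡k
        off : ∀ T → T₀ ≢ T → cell T (e , ∣e∣≡2) ≈ 0#
        off (T , _) T₀≢T with (S △ T) ≟ˢ e
        ... | yes ≡.refl = contradiction (KSubset-≡ (△-cancel S T)) T₀≢T
        ... | no  _      = refl
        on : cell T₀ (e , ∣e∣≡2) ≈ w₀ (e , ∣e∣≡2) * f (S △ e)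
        on with (S △ (S △ e)) ≟ˢ e
        ... | yes _ = refl
        ... | no ¬q = contradiction (△-cancel S e) ¬q
      ... | false = ∑-zero (kSubsets n k) (λ {T} _ → off T)
        where
        off : ∀ T → cell T (e , ∣e∣≡2) ≈ 0#
        off (T , q) with (S △ T) ≟ˢ e
        ... | yes ≡.refl = contradiction (≡.trans (≡.sym eq) (≡1⇒crosses e S (∣S△e∣⇒∣S∩e∣ {S = S} ∣e∣≡2
                (≡.trans (cong ∣_∣ (△-cancel S T)) (≡.trans q (≡.sym ∣S∣≡k)))))) λ ()
        ... | no  _      = refl

    signlessOperator : (Subset n → Carrier) → Subset n → Carrier
    signlessOperator f S = ∑ pairs λ e → w₀ e * mix (proj₁ e) f S

    signless-action : ∀ k f S → mul (kSubsets n k) (tokenSignlessLaplacian ℝ G k) (f ∘ proj₁) S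
      ≈ signlessOperator f (proj₁ S)
    signless-action k f S = begin
      ∑ (kSubsets n k) (λ T → (tokenDegreeMatrix ℝ G k S T + tokenAdjacency ℝ G k S T) * f (proj₁ T))
        ≈⟨ trans (∑-cong (kSubsets n k) (λ T → distribʳ _ _ _)) (∑-+ (kSubsets n k) _ _) ⟩
      mul (kSubsets n k) (tokenDegreeMatrix ℝ G k) (f ∘ proj₁) S + mul (kSubsets n k) (tokenAdjacency ℝ G k) (f ∘ proj₁) S
        ≈⟨ +-cong diagonal (adjacency-action k f S) ⟩
      tokenDegree ℝ G k S * f (proj₁ S) + ∑ pairs (hop f (proj₁ S))
        ≈⟨ +-congʳ (trans (*-comm _ _) (sym (∑-*ˡ pairs _ _))) ⟩
      ∑ pairs (λ e → f (proj₁ S) * (if crosses (proj₁ e) (proj₁ S) then w₀ e else 0#)) + ∑ pairs (hop f (proj₁ S))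
        ≈⟨ trans (sym (∑-+ pairs _ _)) (∑-cong pairs combine) ⟩
      signlessOperator f (proj₁ S) ∎
      where
      open ≈-Reasoning
      diagonal : mul (kSubsets n k) (tokenDegreeMatrix ℝ G k) (f ∘ proj₁) S ≈ tokenDegree ℝ G k S * f (proj₁ S)
      diagonal = trans (∑-single (kSubsets n k) (kSubsets-unique n k) (kSubsets-complete n k S) _ off) on
        where
        off : ∀ T → S ≢ T → tokenDegreeMatrix ℝ G k S T * f (proj₁ T) ≈ 0#
        off T S≢T with proj₁ S ≟ˢ proj₁ T
        ... | yes eq = contradiction (KSubset-≡ eq) S≢T
        ... | no  _  = zeroˡ _
        on : tokenDegreeMatrix ℝ G k S S * f (proj₁ S) ≈ tokenDegree ℝ G k S * f (proj₁ S)
        on with proj₁ S ≟ˢ proj₁ S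
        ... | yes _  = refl
        ... | no S≢S = contradiction ≡.refl S≢S
      combine : ∀ e → f (proj₁ S) * (if crosses (proj₁ e) (proj₁ S) then w₀ e else 0#) + hop f (proj₁ S) e
        ≈ w₀ e * mix (proj₁ e) f (proj₁ S)
      combine e with crosses (proj₁ e) (proj₁ S)
      ... | true  = trans (+-congʳ (*-comm _ _)) (sym (distribˡ _ _ _))
      ... | false = solve 2 (λ w s → s :* con (+ 0) :+ con (+ 0) := w :* con (+ 0)) refl (w₀ e) (f (proj₁ S))

    signless-cone : ∀ {f} → Cone f → Cone (signlessOperator f)
    signless-cone f∈ = cone-∑ pairs (λ e → scaleᶜ (w₀ e) (w₀-nonneg e) (mix-cone (proj₂ e) f∈) (λ S → refl))

    totalWeight : Carrier
    totalWeight = ∑ pairs w₀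

    totalWeight-nonneg : 0# ≤ totalWeight
    totalWeight-nonneg = ∑-nonneg pairs w₀-nonneg

    -- For one edge of weight one the adjacency operator is (τ + h - 1)/2, and the negative
    -- coefficient would leave the cone. Doubling and adding the total weight cancels it, by an
    -- increasing affine change of eigenvalues that is the same on every level.
    shiftedAdjacency : ∀ k → Matrixᴵ {KSubset n k}
    shiftedAdjacency k S T = tokenAdjacency ℝ G k S T + tokenAdjacency ℝ G k S T
      + scalar _≟ᵏ_ (kSubsets-unique n k) (kSubsets-complete n k) totalWeight S T

    mul-shiftedAdjacency : ∀ k v S → mul (kSubsets n k) (shiftedAdjacency k) v S ≈
      mul (kSubsets n k) (tokenAdjacency ℝ G k) v S + mul (kSubsets n k) (tokenAdjacency ℝ G k) v S + totalWeight * v S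
    mul-shiftedAdjacency k v S = trans (∑-cong (kSubsets n k) (λ T → trans (distribʳ _ _ _) (+-congʳ (distribʳ _ _ _))))
      (trans (∑-+ (kSubsets n k) _ _) (+-cong (∑-+ (kSubsets n k) _ _)
        (mul-scalar _≟ᵏ_ (kSubsets-unique n k) (kSubsets-complete n k) totalWeight v S)))

    shiftedAdjacency-sym : ∀ k → Symmetric (shiftedAdjacency k)
    shiftedAdjacency-sym k S T = +-cong (+-cong (adjacency-sym k S T) (adjacency-sym k S T))
      (scalar-sym _≟ᵏ_ (kSubsets-unique n k) (kSubsets-complete n k) totalWeight S T)

    shiftedAdjacency-nonneg : ∀ k → Nonnegative (shiftedAdjacency k)
    shiftedAdjacency-nonneg k S T = +-nonneg (+-nonneg (adjacency-nonneg k S T) (adjacency-nonneg k S T)) diagonal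
      where
      diagonal : 0# ≤ scalar _≟ᵏ_ (kSubsets-unique n k) (kSubsets-complete n k) totalWeight S T
      diagonal with S ≟ᵏ T
      ... | yes _ = totalWeight-nonneg
      ... | no  _ = ≤-refl

    adjacencyOperator : (Subset n → Carrier) → Subset n → Carrier
    adjacencyOperator f S = ∑ pairs λ e → w₀ e * (exchange (proj₁ e) f S + mix (proj₁ e) f S)

    shiftedAdjacency-action : ∀ k f S → mul (kSubsets n k) (shiftedAdjacency k) (f ∘ proj₁) S
      ≈ adjacencyOperator f (proj₁ S)
    shiftedAdjacency-action k f S = begin
      mul (kSubsets n k) (shiftedAdjacency k) (f ∘ proj₁) S
        ≈⟨ mul-shiftedAdjacency k (f ∘ proj₁) S ⟩
      mul (kSubsets n k) (tokenAdjacency ℝ G k) (f ∘ proj₁) S + mul (kSubsets n k) (tokenAdjacency ℝ G k) (f ∘ proj₁) S + totalWeight * f (proj₁ S)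
        ≈⟨ +-cong (+-cong (adjacency-action k f S) (adjacency-action k f S)) (trans (*-comm _ _) (sym (∑-*ˡ pairs _ _))) ⟩
      ∑ pairs (hop f (proj₁ S)) + ∑ pairs (hop f (proj₁ S)) + ∑ pairs (λ e → f (proj₁ S) * w₀ e)
        ≈⟨ trans (+-congʳ (sym (∑-+ pairs _ _))) (trans (sym (∑-+ pairs _ _)) (∑-cong pairs combine)) ⟩
      adjacencyOperator f (proj₁ S) ∎
      where
      open ≈-Reasoning
      combine : ∀ e → hop f (proj₁ S) e + hop f (proj₁ S) e + f (proj₁ S) * w₀ e ≈
                      w₀ e * (exchange (proj₁ e) f (proj₁ S) + mix (proj₁ e) f (proj₁ S))
      combine e with crosses (proj₁ e) (proj₁ S)
      ... | true  = solve 3 (λ w s t → w :* t :+ w :* t :+ s :* w := w :* (t :+ (s :+ t)))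
            refl (w₀ e) (f (proj₁ S)) (f (proj₁ S △ proj₁ e))
      ... | false = solve 2 (λ w s → con (+ 0) :+ con (+ 0) :+ s :* w := w :* (s :+ con (+ 0)))
            refl (w₀ e) (f (proj₁ S))

    adjacency-cone : ∀ {f} → Cone f → Cone (adjacencyOperator f)
    adjacency-cone f∈ = cone-∑ pairs (λ e → scaleᶜ (w₀ e) (w₀-nonneg e)
      (addᶜ (exchange-cone (proj₂ e) f∈) (mix-cone (proj₂ e) f∈) (λ S → refl)) (λ S → refl))

    shift-eigenvector : ∀ {k μ v} → Eigenvector (kSubsets n k) (tokenAdjacency ℝ G k) μ v →
                        Eigenvector (kSubsets n k) (shiftedAdjacency k) (μ + μ + totalWeight) v
    shift-eigenvector {k} {μ} {v} (v≉0 , Av≈μv) = v≉0 , λ S → trans (mul-shiftedAdjacency k v S)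
      (trans (+-congʳ (+-cong (Av≈μv S) (Av≈μv S)))
        (solve 3 (λ μ W x → μ :* x :+ μ :* x :+ W :* x := (μ :+ μ :+ W) :* x) refl μ totalWeight (v S)))

    -- `compare` asks for a bound on every eigenvalue of the shifted matrix, whereas the bound is
    -- known for the adjacency matrix; inverting the affine change carries it over.
    unshift-eigenvector : ∀ {k s v} → Eigenvector (kSubsets n k) (shiftedAdjacency k) s v →
                          Eigenvector (kSubsets n k) (tokenAdjacency ℝ G k) (½ * (s - totalWeight)) v
    unshift-eigenvector {k} {s} {v} (v≉0 , Nv≈sv) = v≉0 , λ S → let a = mul (kSubsets n k) (tokenAdjacency ℝ G k) v S in
      trans (sym (double-halve a)) (trans (solve 3 (λ h a W → h :* a :+ h :* a := h :* (a :+ a :+ W :- W)) refl ½ a (totalWeight * v S))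
        (trans (*-congˡ (+-congʳ (trans (sym (mul-shiftedAdjacency k v S)) (Nv≈sv S))))
          (solve 4 (λ h s W x → h :* (s :* x :- W :* x) := h :* (s :- W) :* x) refl ½ s totalWeight (v S))))

    signless-mono : ∀ k → 2 ℕ.* k ℕ.< n → ∀ μ ν →
      IsLargestEigenvalue ℝ (tokenSignlessLaplacian ℝ G k) μ →
      IsLargestEigenvalue ℝ (tokenSignlessLaplacian ℝ G (suc k)) ν → μ ≤ ν
    signless-mono k 2k<n μ ν ((v , eigen) , _) (_ , largest) =
      compare signlessOperator (tokenSignlessLaplacian ℝ G) signless-sym signless-nonneg signless-action signless-cone
        k 2k<n eigen (λ s u eigen′ → largest s (u , eigen′))

    adjacency-mono : ∀ k → 2 ℕ.* k ℕ.< n → ∀ μ ν →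
      IsLargestEigenvalue ℝ (tokenAdjacency ℝ G k) μ →
      IsLargestEigenvalue ℝ (tokenAdjacency ℝ G (suc k)) ν → μ ≤ ν
    adjacency-mono k 2k<n μ ν ((v , eigen) , _) (_ , largest) = *-cancelˡ-≤ (1# + 1#) 2≰0
      (0≤⇒≤ (≤-respʳ-≈ (solve 3 (λ μ ν W → ν :+ ν :+ W :- (μ :+ μ :+ W) :=
          (con (+ 1) :+ con (+ 1)) :* ν :- (con (+ 1) :+ con (+ 1)) :* μ) refl μ ν totalWeight)
        (≤⇒0≤ (compare adjacencyOperator shiftedAdjacency shiftedAdjacency-sym shiftedAdjacency-nonneg shiftedAdjacency-action
          adjacency-cone k 2k<n (shift-eigenvector eigen) below))))
      where
      below : ∀ s u → Eigenvector (kSubsets n (suc k)) (shiftedAdjacency (suc k)) s u → s ≤ ν + ν + totalWeight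
      below s u eigen′ = ≤-respˡ-≈ (trans (+-congʳ (double-halve (s - totalWeight)))
          (solve 2 (λ s W → s :- W :+ W := s) refl s totalWeight))
        (+-mono-≤ (+-mono-≤ ρ≤ν ρ≤ν) ≤-refl)
        where ρ≤ν = largest _ (u , unshift-eigenvector eigen′)

corollary6p1 : (ℝ : CompleteOrderedField) → let open CompleteOrderedField ℝ using (_≤_) in
    ∀ {n} (G : WeightedGraph ℝ n) (k : ℕ) → 1 ℕ.≤ k → 2 ℕ.* k ℕ.< n →
    (∀ μ ν →
    IsLargestEigenvalue ℝ (tokenSignlessLaplacian ℝ G k) μ →
    IsLargestEigenvalue ℝ (tokenSignlessLaplacian ℝ G (suc k)) ν →
    μ ≤ ν) ×
    (∀ μ ν →
    IsLargestEigenvalue ℝ (tokenAdjacency ℝ G k) μ →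
    IsLargestEigenvalue ℝ (tokenAdjacency ℝ G (suc k)) ν →
    μ ≤ ν)
corollary6p1 ℝ G k _ 2k<n = signless-mono G k 2k<n , adjacency-mono G k 2k<n
  where open TokenGraphs ℝ
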